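{- Let $k\ge 1$ and let $P$ be the fan poset $\mathcal V(\ell_1,\ldots,\ell_k)$, with $\ell_1\ge\cdots\ge\ell_k\ge 2$. Then: (i) If $k=1$ or if $\ell_1-1>\ell_2>\cdots>\ell_k$, then $P$ is uniformly L-bounded. (ii) If $\ell_1>\ell_2>\cdots>\ell_k$, then $P$ is centrally L-bounded. (iii) If $\ell_1>\ell_2$, then $P$ is L-bounded. (iv) If $\ell_1=\ell_2$, then $P$ is not L-bounded, but it is lower-L-bounded. (Conditions mentioning $\ell_2$ in (iii) and (iv) presuppose $k\ge2$.)
   Context: All posets are finite and nonempty. Let $[n]=\{1,\dots,n\}$; families of subsets of $[n]$ are ordered by inclusion. A poset $(P,\le)$ contains a poset $(P',\le')$ as a (weak) subposet if there is an injection $f:P'\to P$ such that $u\le' v$ implies $f(u)\le f(v)$. A family $\mathcal F\subseteq 2^{[n]}$ is $P$-free if it does not contain $P$ in this sense. $e(P)$ is the maximum integer $k\ge 0$ such that for all integers $n$ and $s$ the family $\binom{[n]}{s}\cup\binom{[n]}{s+1}\cup\cdots\cup\binom{[n]}{s+k-1}$ is $P$-free, where $\binom{[n]}{j}$ is the collection of $j$-element subsets of $[n]$ (empty if $j<0$ or $j>n$). The Lubell function of $\mathcal F\subseteq 2^{[n]}$ is the average over all $n!$ full (maximal) chains $\mathcal C$ of $2^{[n]}$ of $|\mathcal F\cap\mathcal C|$; equivalently $\bar h_n(\mathcal F)=\sum_{F\in\mathcal F}1/\binom{n}{|F|}$. For an integer $m\ge0$, $P$ is $m$-L-bounded if for all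 $n$, $\bar h_n(\mathcal F)\le e(P)$ for every $P$-free family $\mathcal F$ of subsets of $[n]$ all of whose members have sizes in $[m,n-m]$. $P$ is uniformly L-bounded if it is $0$-L-bounded, centrally L-bounded if it is $1$-L-bounded, and L-bounded if it is $m$-L-bounded for some integer $m\ge 0$. $P$ is lower-L-bounded if for any $\beta\in(\frac12,1)$ and $\varepsilon>0$ there exists $N=N(\beta,\varepsilon)$ such that for all $n\ge N$, $\bar h_n(\mathcal F)\le e(P)+\varepsilon$ for all $P$-free families $\mathcal F$ of subsets of $[n]$ of sizes less than $\beta n$. Let $\mathcal P_\ell$ denote the chain with $\ell$ elements. For $\ell_1\ge\cdots\ge\ell_k\ge2$, the fan $\mathcal V(\ell_1,\ldots,\ell_k)$ is the poset obtained from disjoint chains $\mathcal P_{\ell_1},\ldots,\mathcal P_{\ell_k}$ by identifying their minimum elements (elements of different chains other than the common minimum are incomparable). -}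

module Defs where

open import Data.Fin as Fin using (Fin)
import Data.Fin.Properties as Fin
open import Data.Fin.Subset using (Subset; ∣_∣)
open import Data.Fin.Subset.Properties using (∣p∣≤n; ⊆-poset)
open import Data.Integer as ℤ using (ℤ; +_)
open import Data.List using (List; length; lookup; map; foldr)
open import Data.List.Membership.Propositional using (_∈_)
open import Data.List.Relation.Unary.Unique.Propositional using (Unique)
open import Data.Nat using (ℕ; zero; suc; pred; _+_; _≤_; z≤n; s≤s; NonZero; >-nonZero; >-nonZero⁻¹)
open import Data.Nat.Combinatorics using (_C_; nCk+nC[k+1]≡[n+1]C[k+1])
open import Data.Nat.Properties using (≤-trans; m≤m+n; ≤-reflexive)
open import Data.Product using (Σ; ∃; _×_; _,_; proj₁)
open import Data.Rational as ℚ using (ℚ; 0ℚ; 1ℚ; ½)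
open import Function.Definitions using (Injective)
open import Level using (0ℓ)
open import Relation.Binary using (Poset)
import Relation.Binary.Construct.On as On
open import Relation.Binary.PropositionalEquality using (_≡_; refl; isEquivalence)
open import Relation.Nullary using (¬_)
open import Relation.Unary using (Pred)

-- Weak (not necessarily induced) containment.
Contains : (P′ P : Poset 0ℓ 0ℓ 0ℓ) → Set
Contains P′ P =
  Σ (P′.Carrier → P.Carrier) λ f →
    Injective P′._≈_ P._≈_ f × (∀ u v → u P′.≤ v → f u P.≤ f v)
  where
  module P′ = Poset P′
  module P  = Poset P

-- The sets satisfying 𝓕, ordered by inclusion; the membership proofs are
-- irrelevant to both equality and order.
familyPoset : ∀ {n} → Pred (Subset n) 0ℓ → Poset 0ℓ 0ℓ 0ℓ
familyPoset {n} 𝓕 = On.poset (⊆-poset n) (proj₁ {B = 𝓕})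

infix 4 _isFreeOf_
_isFreeOf_ : ∀ {n} → Pred (Subset n) 0ℓ → Poset 0ℓ 0ℓ 0ℓ → Set
𝓕 isFreeOf P = ¬ Contains P (familyPoset 𝓕)

-- The k consecutive levels of sizes s, …, s + k − 1.
levels : (n : ℕ) (s : ℤ) (k : ℕ) → Pred (Subset n) 0ℓ
levels n s k S = s ℤ.≤ + ∣ S ∣ × + ∣ S ∣ ℤ.< s ℤ.+ + k

LevelsFree : Poset 0ℓ 0ℓ 0ℓ → ℕ → Set
LevelsFree P k = (n : ℕ) (s : ℤ) → levels n s k isFreeOf P

-- e(P) as a functional relation: e is the maximum of { k | LevelsFree P k }.
IsE : Poset 0ℓ 0ℓ 0ℓ → ℕ → Set
IsE P e = LevelsFree P e × (∀ k → LevelsFree P k → k ≤ e)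

nCk-nonZero : ∀ {n k} → k ≤ n → NonZero (n C k)
nCk-nonZero {k = zero} z≤n = _
nCk-nonZero {suc n} {suc k} (s≤s k≤n) = >-nonZero
  (≤-trans (>-nonZero⁻¹ (n C k) {{nCk-nonZero k≤n}})
  (≤-trans (m≤m+n (n C k) (n C suc k))
           (≤-reflexive (nCk+nC[k+1]≡[n+1]C[k+1] n k))))

lubellWeight : ∀ {n} → Subset n → ℚ
lubellWeight {n} S = ℚ._/_ (+ 1) (n C ∣ S ∣) {{nCk-nonZero (∣p∣≤n S)}}

-- Families entering the Lubell function are duplicate-free lists of subsets;
-- every quantification over them below assumes Unique.
-- Σ_{F ∈ 𝓕} 1 / (n choose |F|) is the average of |𝓕 ∩ 𝓒| over all n! full
-- chains 𝓒, since a set F lies on a full chain in a proportion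
-- 1 / (n choose |F|) of the cases.
lubell : ∀ {n} → List (Subset n) → ℚ
lubell 𝓕 = foldr ℚ._+_ 0ℚ (map lubellWeight 𝓕)

fromℕ : ℕ → ℚ
fromℕ m = + m ℚ./ 1

-- The size condition |S| + m ≤ n is |S| ≤ n − m without truncated subtraction.
IsLBoundedAt : Poset 0ℓ 0ℓ 0ℓ → ℕ → Set
IsLBoundedAt P m = ∃ λ e → IsE P e ×
  ((n : ℕ) (𝓕 : List (Subset n)) → Unique 𝓕 →
   (∀ S → S ∈ 𝓕 → m ≤ ∣ S ∣ × ∣ S ∣ + m ≤ n) →
   (_∈ 𝓕) isFreeOf P →
   lubell 𝓕 ℚ.≤ fromℕ e)

IsUniformlyLBounded : Poset 0ℓ 0ℓ 0ℓ → Set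
IsUniformlyLBounded P = IsLBoundedAt P 0

IsCentrallyLBounded : Poset 0ℓ 0ℓ 0ℓ → Set
IsCentrallyLBounded P = IsLBoundedAt P 1

IsLBounded : Poset 0ℓ 0ℓ 0ℓ → Set
IsLBounded P = ∃ λ m → IsLBoundedAt P m

-- Rational β and ε lose nothing against real ones: the condition for (β , ε)
-- follows from the one for any (β′ , ε′) with β ≤ β′ < 1 and 0 < ε′ ≤ ε.
IsLowerLBounded : Poset 0ℓ 0ℓ 0ℓ → Set
IsLowerLBounded P = ∃ λ e → IsE P e ×
  ((β ε : ℚ) → ½ ℚ.< β → β ℚ.< 1ℚ → 0ℚ ℚ.< ε →
   ∃ λ N → (n : ℕ) → N ≤ n →
   (𝓕 : List (Subset n)) → Unique 𝓕 →
   (∀ S → S ∈ 𝓕 → fromℕ ∣ S ∣ ℚ.< β ℚ.* fromℕ n) →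
   (_∈ 𝓕) isFreeOf P →
   lubell 𝓕 ℚ.≤ fromℕ e ℚ.+ ε)

-- The common minimum, together with the ℓᵢ − 1 remaining elements of each
-- chain i.
data FanCarrier (ℓs : List ℕ) : Set where
  root : FanCarrier ℓs
  node : (i : Fin (length ℓs)) → Fin (pred (lookup ℓs i)) → FanCarrier ℓs

data FanLeq (ℓs : List ℕ) : FanCarrier ℓs → FanCarrier ℓs → Set where
  root≤ : ∀ {v} → FanLeq ℓs root v
  node≤ : ∀ {i a b} → a Fin.≤ b → FanLeq ℓs (node i a) (node i b)

fan : List ℕ → Poset 0ℓ 0ℓ 0ℓ
fan ℓs = record
  { Carrier = FanCarrier ℓs
  ; _≈_ = _≡_
  ; _≤_ = FanLeq ℓs
  ; isPartialOrder = record
    { isPreorder = record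
      { isEquivalence = isEquivalence
      ; reflexive = λ { refl → reflx _ }
      ; trans = transx
      }
    ; antisym = antisymx
    }
  }
  where
  reflx : ∀ u → FanLeq ℓs u u
  reflx root = root≤
  reflx (node i a) = node≤ Fin.≤-refl

  transx : ∀ {u v w} → FanLeq ℓs u v → FanLeq ℓs v w → FanLeq ℓs u w
  transx root≤ _ = root≤
  transx (node≤ p) (node≤ q) = node≤ (Fin.≤-trans p q)

  antisymx : ∀ {u v} → FanLeq ℓs u v → FanLeq ℓs v u → u ≡ v
  antisymx root≤ root≤ = refl
  antisymx (node≤ p) (node≤ q) with refl ← Fin.≤-antisym p q = refl

{-# OPTIONS --safe #-}
module Submission where

-- Write 𝓕 for a fan-free family and N = n − |A| for the corank of a set A.
-- Counting maximal chains upwards from A, it suffices to bound, for every A ∈ 𝓕,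
-- the average number of members of 𝓕 on a maximal chain of [A, [n]]: chains are
-- grouped by their lowest member of 𝓕.  Above A, remove disjoint chains of
-- ℓ₁ − 1, ℓ₂ − 1, … members greedily.  They cannot all exist, since together with A
-- they would form the fan; if no chain of ℓᵢ − 1 members is left, the remaining
-- members contribute at most ℓᵢ − 2 to the average.  Every removed member other than
-- [n] contributes at most 1 / N, so a removed chain contributes at most 1, and at
-- most ε altogether if N is large.  Conversely, if ℓ₁ = ℓ₂, then ℓ₁ − 1 full
-- levels plus one more set above them are fan-free.

open import Defs
open import Algebra.Properties.CommutativeSemigroup using (interchange)
open import Data.Bool using (if_then_else_)
import Data.Bool.Properties as Bool
open import Data.Empty using (⊥-elim)
open import Data.Fin as Fin using (Fin; zero; suc; toℕ; combine; inject≤)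
import Data.Fin.Properties as Fin
open import Data.Fin.Subset as Subset using (Subset; inside; outside; ∣_∣; _⊆_; _⊂_; ⁅_⁆; _∪_)
open import Data.Fin.Subset.Properties hiding (_∈?_)
open import Data.Integer as ℤ using (-[1+_]; +[1+_])
import Data.Integer.Properties as ℤ
open import Data.List using (List; []; _∷_; length; map; filter; tabulate; _++_; lookup)
import Data.List.Membership.DecPropositional as DecPropositional
open import Data.List.Membership.Propositional using (_∈_; _∉_)
open import Data.List.Membership.Propositional.Properties
  using (∈-filter⁻; ∈-tabulate⁺; ∈-∃++; ∈-map⁻; ∈-++⁻; ∈-lookup)
open import Data.List.Properties using (map-∘; length-map; length-++; length-tabulate; map-++)
import Data.List.Relation.Binary.Permutation.Propositional.Properties as ↭
open import Data.List.Relation.Unary.All as All using (All; []; _∷_)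
import Data.List.Relation.Unary.All.Properties as All
open import Data.List.Relation.Unary.AllPairs using ([]; _∷_)
open import Data.List.Relation.Unary.Any using (here; there)
open import Data.List.Relation.Unary.Linked using (Linked; [-]; _∷_)
open import Data.List.Relation.Unary.Linked.Properties using (Linked⇒All)
open import Data.List.Relation.Unary.Unique.Propositional using (Unique)
import Data.List.Relation.Unary.Unique.Propositional.Properties as Unique
open import Data.Nat hiding (_≟_)
open import Data.Nat.Combinatorics
  using (_C_; nCk≡n!/k![n-k]!; k![n∸k]!∣n!; nCk+nC[k+1]≡[n+1]C[k+1])
open import Data.Nat.DivMod using (m/n*n≡m)
open import Data.Nat.ListAction using (sum)
open import Data.Nat.ListAction.Properties using (sum-↭; sum-++)
open import Data.Nat.Properties hiding (_≟_)
open import Data.Nat.Tactic.RingSolver using (solve-∀)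
open import Data.Product using (Σ; ∃; _×_; _,_; proj₁; proj₂)
open import Data.Rational as ℚ using (ℚ; mkℚ; 0ℚ; 1ℚ; ½; toℚᵘ)
import Data.Rational.Properties as ℚ
open import Data.Rational.Unnormalised as ℚᵘ using (mkℚᵘ; *≡*; *≤*; *<*)
import Data.Rational.Unnormalised.Properties as ℚᵘ
open import Data.Sum using (_⊎_; inj₁; inj₂)
open import Data.Unit using (⊤; tt)
open import Data.Vec using ([]; _∷_)
import Data.Vec as Vec
import Data.Vec.Properties as Vec
open import Function using (_∘_; id; case_of_)
open import Level using (0ℓ)
open import Relation.Binary using (DecidableEquality; Poset; tri<; tri≈; tri>)
open import Relation.Binary.PropositionalEquality
open import Relation.Nullary using (¬_; Dec; yes; no; does; ¬?)
open import Relation.Nullary.Decidable using (dec-true)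
open import Relation.Unary using (Pred)

private variable
  n : ℕ
  I : Set

-- Decidable equality and strict inclusion of subsets

_≟_ : DecidableEquality (Subset n)
_≟_ = Vec.≡-dec Bool._≟_

_∈?_ : (S : Subset n) (𝓕 : List (Subset n)) → Dec (S ∈ 𝓕)
_∈?_ = DecPropositional._∈?_ _≟_

⊆∧≢⇒⊂ : ∀ {A B : Subset n} → A ⊆ B → A ≢ B → A ⊂ B
⊆∧≢⇒⊂ {A = []} {[]} _ A≢B = ⊥-elim (A≢B refl)
⊆∧≢⇒⊂ {A = inside ∷ A}  {inside ∷ B}  A⊆B A≢B = s⊂s (⊆∧≢⇒⊂ (drop-∷-⊆ A⊆B) (A≢B ∘ cong (inside ∷_)))
⊆∧≢⇒⊂ {A = outside ∷ A} {outside ∷ B} A⊆B A≢B = s⊂s (⊆∧≢⇒⊂ (drop-∷-⊆ A⊆B) (A≢B ∘ cong (outside ∷_)))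
⊆∧≢⇒⊂ {A = outside ∷ A} {inside ∷ B}  A⊆B A≢B = out⊂in (drop-∷-⊆ A⊆B)
⊆∧≢⇒⊂ {A = inside ∷ A}  {outside ∷ B} A⊆B A≢B with () ← A⊆B Vec.here

⊆∧≢⇒< : ∀ {A B : Subset n} → A ⊆ B → A ≢ B → ∣ A ∣ < ∣ B ∣
⊆∧≢⇒< A⊆B A≢B = p⊂q⇒∣p∣<∣q∣ (⊆∧≢⇒⊂ A⊆B A≢B)

-- Sums over lists

sum-map-≤ : ∀ (f g : I → ℕ) {xs} → All (λ x → f x ≤ g x) xs → sum (map f xs) ≤ sum (map g xs)
sum-map-≤ f g [] = z≤n
sum-map-≤ f g (fx≤gx ∷ f≤g) = +-mono-≤ fx≤gx (sum-map-≤ f g f≤g)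

sum-map-≤-const : ∀ (f : I → ℕ) {k xs} → All (λ x → f x ≤ k) xs → sum (map f xs) ≤ length xs * k
sum-map-≤-const f [] = z≤n
sum-map-≤-const f (fx≤k ∷ f≤k) = +-mono-≤ fx≤k (sum-map-≤-const f f≤k)

sum-map-+ : ∀ (f g : I → ℕ) xs → sum (map (λ x → f x + g x) xs) ≡ sum (map f xs) + sum (map g xs)
sum-map-+ f g [] = refl
sum-map-+ f g (x ∷ xs) = trans (cong (f x + g x +_) (sum-map-+ f g xs))
  (interchange +-commutativeSemigroup (f x) (g x) _ _)

sum-map-* : ∀ k (f : I → ℕ) xs → sum (map (λ x → k * f x) xs) ≡ k * sum (map f xs)
sum-map-* k f [] = sym (*-zeroʳ k)
sum-map-* k f (x ∷ xs) = trans (cong (k * f x +_) (sum-map-* k f xs)) (sym (*-distribˡ-+ k (f x) _))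

sum-map-0 : ∀ (xs : List I) → sum (map (λ _ → 0) xs) ≡ 0
sum-map-0 [] = refl
sum-map-0 (x ∷ xs) = sum-map-0 xs

sum-map-swap : ∀ {J : Set} (f : I → J → ℕ) xs ys →
  sum (map (λ x → sum (map (f x) ys)) xs) ≡ sum (map (λ y → sum (map (λ x → f x y) xs)) ys)
sum-map-swap f [] ys = sym (sum-map-0 ys)
sum-map-swap f (x ∷ xs) ys = trans (cong (sum (map (f x) ys) +_) (sum-map-swap f xs ys))
  (sym (sum-map-+ (f x) _ ys))

-- Each element of `xs` is moved to the front of `ys` and cancelled; as `xs` has no duplicates, its
-- remaining elements are still found in what is left of `ys`.
sum-map-⊆ : ∀ (f : I → ℕ) {xs ys} → Unique xs → (∀ {x} → x ∈ xs → x ∈ ys) → sum (map f xs) ≤ sum (map f ys)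
sum-map-⊆ f {[]} _ _ = z≤n
sum-map-⊆ f {x ∷ xs} {ys} (x∉xs ∷ xs!) xs⊆ys
  with us , vs , refl ← ∈-∃++ (xs⊆ys (here refl)) = begin
    f x + sum (map f xs)          ≤⟨ +-monoʳ-≤ (f x) (sum-map-⊆ f xs! rest) ⟩
    f x + sum (map f (us ++ vs))  ≡⟨ sum-↭ (↭.map⁺ f (↭.shift x us vs)) ⟨
    sum (map f (us ++ x ∷ vs))    ∎
  where
  open ≤-Reasoning
  rest : ∀ {y} → y ∈ xs → y ∈ us ++ vs
  rest y∈xs with ↭.∈-resp-↭ (↭.shift x us vs) (xs⊆ys (there y∈xs))
  ... | here refl = ⊥-elim (All.lookup x∉xs y∈xs refl)
  ... | there y∈  = y∈

infixl 5 _∖_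
_∖_ : (xs ys : List (Subset n)) → List (Subset n)
xs ∖ ys = filter (¬? ∘ (_∈? ys)) xs

-- The members of `xs` that lie in `ys` form a duplicate-free part of `ys`, so their sum is at most
-- that of `ys`.
sum-map-∖ : ∀ (f : Subset n → ℕ) xs ys → Unique xs →
  sum (map f xs) ≤ sum (map f ys) + sum (map f (xs ∖ ys))
sum-map-∖ f xs ys xs! = begin
  sum (map f xs)
    ≡⟨ split xs ⟩
  sum (map f (filter (_∈? ys) xs)) + sum (map f (xs ∖ ys))
    ≤⟨ +-monoˡ-≤ _ (sum-map-⊆ f (Unique.filter⁺ (_∈? ys) xs!) (proj₂ ∘ ∈-filter⁻ (_∈? ys) {xs = xs})) ⟩
  sum (map f ys) + sum (map f (xs ∖ ys))
    ∎
  where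
  open ≤-Reasoning
  split : ∀ zs → sum (map f zs) ≡ sum (map f (filter (_∈? ys) zs)) + sum (map f (zs ∖ ys))
  split [] = refl
  split (z ∷ zs) with z ∈? ys
  ... | yes _ = trans (cong (f z +_) (split zs)) (sym (+-assoc (f z) _ _))
  ... | no  _ = trans (cong (f z +_) (split zs)) (trans (sym (+-assoc (f z) a b))
                  (trans (cong (_+ b) (+-comm (f z) a)) (+-assoc a (f z) b)))
    where
    a = sum (map f (filter (_∈? ys) zs))
    b = sum (map f (zs ∖ ys))

all⊎∃ : ∀ {P Q : I → Set} {xs} → All (λ x → P x ⊎ Q x) xs → ∃ P ⊎ All Q xs
all⊎∃ [] = inj₂ []
all⊎∃ (inj₁ p ∷ _) = inj₁ (_ , p)
all⊎∃ (inj₂ q ∷ pqs) with all⊎∃ pqs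
... | inj₁ p  = inj₁ p
... | inj₂ qs = inj₂ (q ∷ qs)

-- Covers of a set, and averaging over maximal chains

covers : Subset n → List (Subset n)
covers []            = []
covers (inside ∷ A)  = map (inside ∷_) (covers A)
covers (outside ∷ A) = (inside ∷ A) ∷ map (outside ∷_) (covers A)

covers-length : ∀ (A : Subset n) → ∣ A ∣ + length (covers A) ≡ n
covers-length []            = refl
covers-length (inside ∷ A)  =
  cong suc (trans (cong (∣ A ∣ +_) (length-map _ (covers A))) (covers-length A))
covers-length (outside ∷ A) = trans (+-suc ∣ A ∣ _)
  (cong suc (trans (cong (∣ A ∣ +_) (length-map _ (covers A))) (covers-length A)))

covers-⊂ : ∀ (A : Subset n) → All (A ⊂_) (covers A)
covers-⊂ []            = []
covers-⊂ (inside ∷ A)  = All.map⁺ (All.map s⊂s (covers-⊂ A))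
covers-⊂ (outside ∷ A) = out⊂in id ∷ All.map⁺ (All.map s⊂s (covers-⊂ A))

covers-size : ∀ (A : Subset n) → All (λ B → ∣ B ∣ ≡ suc ∣ A ∣) (covers A)
covers-size []            = []
covers-size (inside ∷ A)  = All.map⁺ (All.map (cong suc) (covers-size A))
covers-size (outside ∷ A) = refl ∷ All.map⁺ (covers-size A)

-- Exactly |F| - |A| covers of `A` lie inside `F`; the additive form avoids truncated subtraction.
covers-below : ∀ k {A F : Subset n} → A ⊆ F →
  sum (map (λ B → if does (B ⊆? F) then k else 0) (covers A)) + ∣ A ∣ * k ≡ ∣ F ∣ * k
covers-below k {[]} {[]} _ = refl
covers-below k {inside ∷ A} {outside ∷ F} A⊆F with () ← A⊆F Vec.here
covers-below k {inside ∷ A} {inside ∷ F} A⊆F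
  rewrite sym (map-∘ {g = λ B → if does (B ⊆? (inside ∷ F)) then k else 0} {f = inside ∷_} (covers A)) =
  trans (lemma (sum (map (λ B → if does (B ⊆? F) then k else 0) (covers A))) k (∣ A ∣ * k))
        (cong (k +_) (covers-below k (drop-∷-⊆ A⊆F)))
  where
  lemma : ∀ x y z → x + (y + z) ≡ y + (x + z)
  lemma = solve-∀
covers-below k {outside ∷ A} {inside ∷ F} A⊆F
  rewrite sym (map-∘ {g = λ B → if does (B ⊆? (inside ∷ F)) then k else 0} {f = outside ∷_} (covers A))
        | dec-true (A ⊆? F) (drop-∷-⊆ A⊆F) =
  trans (+-assoc k _ _) (cong (k +_) (covers-below k (drop-∷-⊆ A⊆F)))
covers-below k {outside ∷ A} {outside ∷ F} A⊆F
  rewrite sym (map-∘ {g = λ B → if does (B ⊆? (outside ∷ F)) then k else 0} {f = outside ∷_} (covers A)) =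
  covers-below k (drop-∷-⊆ A⊆F)

-- The number of maximal chains of the interval [A, [n]] that pass through F.
chainsVia : (A F : Subset n) → ℕ
chainsVia {n} A F = if does (A ⊆? F) then (∣ F ∣ ∸ ∣ A ∣) ! * (n ∸ ∣ F ∣) ! else 0

chainsVia-⊥ : ∀ (S : Subset n) → chainsVia Subset.⊥ S ≡ ∣ S ∣ ! * (n ∸ ∣ S ∣) !
chainsVia-⊥ {n} S rewrite dec-true (Subset.⊥ ⊆? S) ⊥⊆ | ∣⊥∣≡0 n = refl

-- For `A` of corank N this is N ! times the average number of members of `𝓕` on a maximal chain of
-- [A, [n]].
weight : List (Subset n) → Subset n → ℕ
weight 𝓕 A = sum (map (chainsVia A) 𝓕)

<⇒∸≡suc : ∀ {m n} → m < n → n ∸ m ≡ suc (n ∸ suc m)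
<⇒∸≡suc (s≤s m≤n) = +-∸-assoc 1 m≤n

-- A maximal chain of [A, [n]] through `F` leaves `A` by one of the |F| - |A| covers below `F`, and
-- each such cover carries the same number `k` of chains.
chainsVia-cover : ∀ (A F : Subset n) → A ≢ F → chainsVia A F ≤ sum (map (λ B → chainsVia B F) (covers A))
chainsVia-cover {n} A F A≢F with A ⊆? F
... | no  _   = z≤n
... | yes A⊆F = begin
  (∣ F ∣ ∸ ∣ A ∣) ! * t !                    ≡⟨ cong (λ m → m ! * t !) F∸A ⟩
  suc d * d ! * t !                          ≡⟨ *-assoc (suc d) (d !) (t !) ⟩
  suc d * k                                  ≡⟨ cong (_* k) F∸A ⟨
  (∣ F ∣ ∸ ∣ A ∣) * k                        ≡⟨ *-distribʳ-∸ k ∣ F ∣ ∣ A ∣ ⟩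
  ∣ F ∣ * k ∸ ∣ A ∣ * k                      ≡⟨ cong (_∸ ∣ A ∣ * k) (covers-below k A⊆F) ⟨
  s + ∣ A ∣ * k ∸ ∣ A ∣ * k                  ≡⟨ m+n∸n≡m s (∣ A ∣ * k) ⟩
  s
    ≤⟨ sum-map-≤ via (λ B → chainsVia B F) (All.map (λ {B} → below B) (covers-size A)) ⟩
  sum (map (λ B → chainsVia B F) (covers A)) ∎
  where
  open ≤-Reasoning
  d = ∣ F ∣ ∸ suc ∣ A ∣
  t = n ∸ ∣ F ∣
  k = d ! * t !
  via : Subset n → ℕ
  via B = if does (B ⊆? F) then k else 0
  s = sum (map via (covers A))
  F∸A : ∣ F ∣ ∸ ∣ A ∣ ≡ suc d
  F∸A = <⇒∸≡suc (⊆∧≢⇒< A⊆F A≢F)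
  below : ∀ B → ∣ B ∣ ≡ suc ∣ A ∣ → via B ≤ chainsVia B F
  below B B≡1+A rewrite B≡1+A = ≤-refl

chainsVia-self : ∀ {N} (A : Subset n) → ∣ A ∣ + N ≡ n → chainsVia A A ≡ N !
chainsVia-self {n} {N} A A+N≡n
  rewrite dec-true (A ⊆? A) id | n∸n≡0 ∣ A ∣ | trans (cong (_∸ ∣ A ∣) (sym A+N≡n)) (m+n∸m≡n ∣ A ∣ N) =
  +-identityʳ (N !)

weight-cover : ∀ (𝓕 : List (Subset n)) A → A ∉ 𝓕 → weight 𝓕 A ≤ sum (map (weight 𝓕) (covers A))
weight-cover 𝓕 A A∉𝓕 = begin
  weight 𝓕 A
    ≤⟨ sum-map-≤ (chainsVia A) (λ F → sum (map (λ B → chainsVia B F) (covers A)))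
         (All.tabulate λ {F} F∈𝓕 → chainsVia-cover A F λ { refl → A∉𝓕 F∈𝓕 }) ⟩
  sum (map (λ F → sum (map (λ B → chainsVia B F) (covers A))) 𝓕)
    ≡⟨ sum-map-swap (λ F B → chainsVia B F) 𝓕 (covers A) ⟩
  sum (map (weight 𝓕) (covers A))
    ∎
  where open ≤-Reasoning

-- `A` lies on all N ! maximal chains of its interval.
weight-∖-self : ∀ (𝓕 : List (Subset n)) {A N} → Unique 𝓕 → ∣ A ∣ + N ≡ n →
  weight 𝓕 A ≤ N ! + weight (𝓕 ∖ (A ∷ [])) A
weight-∖-self 𝓕 {A} {N} 𝓕! A+N≡n = begin
  weight 𝓕 A                                  ≤⟨ sum-map-∖ (chainsVia A) 𝓕 (A ∷ []) 𝓕! ⟩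
  chainsVia A A + 0 + weight (𝓕 ∖ (A ∷ [])) A ≡⟨ cong (_+ weight (𝓕 ∖ (A ∷ [])) A)
                                                   (trans (+-identityʳ _) (chainsVia-self A A+N≡n)) ⟩
  N ! + weight (𝓕 ∖ (A ∷ [])) A               ∎
  where open ≤-Reasoning

∖-∈ : ∀ (𝓕 𝓖 : List (Subset n)) {S} → S ∈ 𝓕 ∖ 𝓖 → S ∈ 𝓕 × S ∉ 𝓖
∖-∈ 𝓕 𝓖 = ∈-filter⁻ (¬? ∘ (_∈? 𝓖)) {xs = 𝓕}

∖-! : ∀ {𝓕 : List (Subset n)} 𝓖 → Unique 𝓕 → Unique (𝓕 ∖ 𝓖)
∖-! 𝓖 = Unique.filter⁺ (¬? ∘ (_∈? 𝓖))

∉-∖-self : ∀ (𝓕 : List (Subset n)) A → A ∉ 𝓕 ∖ (A ∷ [])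
∉-∖-self 𝓕 A A∈ = proj₂ (∖-∈ 𝓕 (A ∷ []) A∈) (here refl)

-- `A` has N covers, each the bottom of an interval with (N - 1) ! maximal chains, so a bound p / q
-- on all their averages passes to `A`. For N = 0 there are no covers and the weight vanishes.
covers-bound : ∀ {p q N} (𝓕 : List (Subset n)) A → A ∉ 𝓕 → ∣ A ∣ + N ≡ n →
  (∀ {N′} → N ≡ suc N′ → All (λ B → q * weight 𝓕 B ≤ p * N′ !) (covers A)) →
  q * weight 𝓕 A ≤ p * N !
covers-bound {p = p} {q} {N} 𝓕 A A∉𝓕 A+N≡n bound = begin
  q * weight 𝓕 A                           ≤⟨ *-monoʳ-≤ q (weight-cover 𝓕 A A∉𝓕) ⟩
  q * sum (map (weight 𝓕) (covers A))      ≡⟨ sum-map-* q (weight 𝓕) (covers A) ⟨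
  sum (map (λ B → q * weight 𝓕 B) (covers A))
    ≤⟨ go N (+-cancelˡ-≡ ∣ A ∣ _ N (trans (covers-length A) (sym A+N≡n))) bound ⟩
  p * N !                                  ∎
  where
  open ≤-Reasoning
  go : ∀ {Bs} N → length Bs ≡ N → (∀ {N′} → N ≡ suc N′ → All (λ B → q * weight 𝓕 B ≤ p * N′ !) Bs) →
    sum (map (λ B → q * weight 𝓕 B) Bs) ≤ p * N !
  go {[]} N _ _ = z≤n
  go {B ∷ Bs} (suc N) len bound = begin
    sum (map (λ B → q * weight 𝓕 B) (B ∷ Bs)) ≤⟨ sum-map-≤-const (λ B → q * weight 𝓕 B) (bound refl) ⟩
    length (B ∷ Bs) * (p * N !)               ≡⟨ cong (_* (p * N !)) len ⟩
    suc N * (p * N !)                         ≡⟨ lemma (suc N) p (N !) ⟩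
    p * (suc N * N !)                         ∎
    where
    lemma : ∀ x y z → x * (y * z) ≡ y * (x * z)
    lemma = solve-∀

-- Walking up from `A` by covers until a member of `𝓕` is met groups the chains by their lowest
-- member; a chain that meets none contributes nothing.
averaging : ∀ {p q} (𝓕 : List (Subset n)) →
  (∀ {A N} → A ∈ 𝓕 → ∣ A ∣ + N ≡ n → q * weight 𝓕 A ≤ p * N !) →
  ∀ {N} A → ∣ A ∣ + N ≡ n → q * weight 𝓕 A ≤ p * N !
averaging {n} {p} {q} 𝓕 bound {N} A A+N≡n = go N A A+N≡n
  where
  go : ∀ N A → ∣ A ∣ + N ≡ n → q * weight 𝓕 A ≤ p * N !
  go N A A+N≡n with A ∈? 𝓕
  ... | yes A∈𝓕 = bound A∈𝓕 A+N≡n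
  go zero A A+N≡n | no A∉𝓕 = covers-bound {p = p} {q} 𝓕 A A∉𝓕 A+N≡n (λ ())
  go (suc N) A A+N≡n | no A∉𝓕 = covers-bound {p = p} {q} 𝓕 A A∉𝓕 A+N≡n λ where
    refl → All.map
      (λ {B} B≡1+A → go N B (trans (cong (_+ N) B≡1+A) (trans (sym (+-suc ∣ A ∣ N)) A+N≡n)))
      (covers-size A)

-- Chains of members above a set

-- `above` is not strict, so the lowest set may be `A` itself.
record Chain (A : Subset n) (P : Pred (Subset n) 0ℓ) (b : ℕ) : Set where
  field
    at         : Fin b → Subset n
    increasing : ∀ {i j} → i Fin.< j → at i ⊂ at j
    above      : ∀ i → A ⊆ at i
    member     : ∀ i → P (at i)

open Chain

emptyChain : ∀ {A : Subset n} {P} → Chain A P 0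
emptyChain = record { at = λ () ; increasing = λ {} ; above = λ () ; member = λ () }

consChain : ∀ {A B : Subset n} {P b} → P A → A ⊂ B → Chain B P b → Chain A P (suc b)
consChain {A = A} PA A⊂B c = record
  { at         = λ { zero → A ; (suc i) → at c i }
  ; increasing = λ { {zero}  {suc j} _   → ⊂-⊆-trans A⊂B (above c j)
                   ; {suc i} {suc j} i<j → increasing c (s≤s⁻¹ i<j) }
  ; above      = λ { zero → id ; (suc i) → ⊆-trans (p⊂q⇒p⊆q A⊂B) (above c i) }
  ; member     = λ { zero → PA ; (suc i) → member c i }
  }

chain-map : ∀ {A B : Subset n} {P Q : Pred (Subset n) 0ℓ} {b} →
  B ⊆ A → (∀ {S} → P S → Q S) → Chain A P b → Chain B Q b
chain-map B⊆A P⊆Q c = record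
  { at         = at c
  ; increasing = increasing c
  ; above      = λ i → ⊆-trans B⊆A (above c i)
  ; member     = λ i → P⊆Q (member c i)
  }

mutual
  -- Without `a` + 1 nested members above `A`, every maximal chain of [A, [n]] meets `𝓕` at most `a`
  -- times. If `A` is a member, it is removed, which uses up one of the `a` and N ! of the weight.
  longChain : ∀ N (𝓕 : List (Subset n)) A → Unique 𝓕 → ∣ A ∣ + N ≡ n →
    ∀ a → Chain A (_∈ 𝓕) (suc a) ⊎ weight 𝓕 A ≤ a * N !
  longChain N 𝓕 A 𝓕! A+N≡n a with A ∈? 𝓕
  longChain N 𝓕 A 𝓕! A+N≡n a | no A∉𝓕 with longChainAbove N 𝓕 A 𝓕! A∉𝓕 A+N≡n a
  ... | inj₁ (B , A⊂B , c) = inj₁ (chain-map (p⊂q⇒p⊆q A⊂B) id c)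
  ... | inj₂ w≤            = inj₂ w≤
  longChain N 𝓕 A 𝓕! A+N≡n zero | yes A∈𝓕 = inj₁ record
    { at = λ _ → A ; increasing = λ { {zero} {zero} () } ; above = λ _ → id ; member = λ _ → A∈𝓕 }
  longChain N 𝓕 A 𝓕! A+N≡n (suc a) | yes A∈𝓕
    with longChainAbove N (𝓕 ∖ (A ∷ [])) A (∖-! (A ∷ []) 𝓕!) (∉-∖-self 𝓕 A) A+N≡n a
  ... | inj₁ (B , A⊂B , c) = inj₁ (consChain A∈𝓕 A⊂B (chain-map id (proj₁ ∘ ∖-∈ 𝓕 (A ∷ [])) c))
  ... | inj₂ w≤ = inj₂ (≤-trans (weight-∖-self 𝓕 𝓕! A+N≡n) (+-monoʳ-≤ (N !) w≤))

  -- Every cover `B` of `A` is searched. A chain found there starts strictly above `A`, so `A` can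
  -- be put in front of it; if all searches fail, the bounds on the covers are averaged.
  longChainAbove : ∀ N (𝓕 : List (Subset n)) A → Unique 𝓕 → A ∉ 𝓕 → ∣ A ∣ + N ≡ n →
    ∀ a → (∃ λ B → A ⊂ B × Chain B (_∈ 𝓕) (suc a)) ⊎ weight 𝓕 A ≤ a * N !
  longChainAbove zero 𝓕 A 𝓕! A∉𝓕 A+N≡n a =
    inj₂ (subst (_≤ a * 1) (*-identityˡ _) (covers-bound {p = a} {1} 𝓕 A A∉𝓕 A+N≡n λ ()))
  longChainAbove (suc N) 𝓕 A 𝓕! A∉𝓕 A+N≡n a
    with all⊎∃ (All.map (λ {B} → search B) (All.zip (covers-⊂ A , covers-size A)))
    where
    search : ∀ B → A ⊂ B × ∣ B ∣ ≡ suc ∣ A ∣ →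
      (A ⊂ B × Chain B (_∈ 𝓕) (suc a)) ⊎ 1 * weight 𝓕 B ≤ a * N !
    search B (A⊂B , B≡1+A)
      with longChain N 𝓕 B 𝓕! (trans (cong (_+ N) B≡1+A) (trans (sym (+-suc ∣ A ∣ N)) A+N≡n)) a
    ... | inj₁ c  = inj₁ (A⊂B , c)
    ... | inj₂ w≤ = inj₂ (subst (_≤ a * N !) (sym (*-identityˡ _)) w≤)
  ... | inj₁ found = inj₁ found
  ... | inj₂ bound = inj₂ (subst (_≤ a * suc N !) (*-identityˡ _)
                       (covers-bound {p = a} {1} 𝓕 A A∉𝓕 A+N≡n λ { refl → bound }))

snoc : ∀ {b} → (Fin b → Subset n) → Subset n → Fin (suc b) → Subset n
snoc {b = zero}  f B _       = B
snoc {b = suc b} f B zero    = f zero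
snoc {b = suc b} f B (suc i) = snoc (f ∘ suc) B i

snoc-all : ∀ {b} (P : Pred (Subset n) 0ℓ) (f : Fin b → Subset n) {B} →
  (∀ i → P (f i)) → P B → ∀ i → P (snoc f B i)
snoc-all {b = zero}  P f Pf PB i       = PB
snoc-all {b = suc b} P f Pf PB zero    = Pf zero
snoc-all {b = suc b} P f Pf PB (suc i) = snoc-all P (f ∘ suc) (Pf ∘ suc) PB i

snoc-increasing : ∀ {b} (f : Fin b → Subset n) {B} → (∀ {i j} → i Fin.< j → f i ⊂ f j) → (∀ i → f i ⊂ B) →
  ∀ i j → i Fin.< j → snoc f B i ⊂ snoc f B j
snoc-increasing {b = zero}  f _   _   zero    zero    ()
snoc-increasing {b = suc b} f inc f⊂B zero    (suc j) _   =
  snoc-all (f zero ⊂_) (f ∘ suc) (λ i → inc (s≤s z≤n)) (f⊂B zero) j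
snoc-increasing {b = suc b} f inc f⊂B (suc i) (suc j) i<j =
  snoc-increasing (f ∘ suc) (inc ∘ s≤s) (f⊂B ∘ suc) i j (s≤s⁻¹ i<j)

snocChain : ∀ {A B : Subset n} {P b} (c : Chain A P b) → A ⊆ B → (∀ i → at c i ⊂ B) → P B → Chain A P (suc b)
snocChain {A = A} {B} {P} c A⊆B c⊂B PB = record
  { at         = snoc (at c) B
  ; increasing = λ {i} {j} → snoc-increasing (at c) (increasing c) c⊂B i j
  ; above      = snoc-all (A ⊆_) (at c) (above c) A⊆B
  ; member     = snoc-all P (at c) (member c) PB
  }

increasing⇒≥ : ∀ {b} (g : Fin b → ℕ) {lo} → (∀ {i j} → i Fin.< j → g i < g j) → (∀ i → lo ≤ g i) →
  ∀ i → lo + toℕ i ≤ g i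
increasing⇒≥ g {lo} inc lo≤ zero = subst (_≤ g zero) (sym (+-identityʳ lo)) (lo≤ zero)
increasing⇒≥ g {lo} inc lo≤ (suc i) = subst (_≤ g (suc i)) (sym (+-suc lo (toℕ i)))
  (increasing⇒≥ (g ∘ suc) (inc ∘ s≤s) (λ j → ≤-trans (s≤s (lo≤ zero)) (inc (s≤s z≤n))) i)

-- The members have distinct sizes among |A| + 1, ..., n.
chain-length : ∀ {A : Subset n} {N P b} → ∣ A ∣ + N ≡ n → (c : Chain A P b) → (∀ i → A ≢ at c i) → b ≤ N
chain-length {b = zero} _ _ _ = z≤n
chain-length {n} {A} {N} {b = suc b} A+N≡n c A≢ = +-cancelˡ-≤ ∣ A ∣ (suc b) N (begin
  ∣ A ∣ + suc b               ≡⟨ +-suc ∣ A ∣ b ⟩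
  suc ∣ A ∣ + b               ≡⟨ cong (suc ∣ A ∣ +_) (Fin.toℕ-fromℕ b) ⟨
  suc ∣ A ∣ + toℕ (Fin.fromℕ b)
    ≤⟨ increasing⇒≥ (∣_∣ ∘ at c) (p⊂q⇒∣p∣<∣q∣ ∘ increasing c) (λ i → ⊆∧≢⇒< (above c i) (A≢ i)) (Fin.fromℕ b) ⟩
  ∣ at c (Fin.fromℕ b) ∣      ≤⟨ ∣p∣≤n (at c (Fin.fromℕ b)) ⟩
  n                           ≡⟨ A+N≡n ⟨
  ∣ A ∣ + N                   ∎)
  where open ≤-Reasoning

-- Disjoint chains above a set and copies of the fan

-- Disjointness sits in the predicate, which grows with each chain to exclude its members. A chain
-- has `pred ℓ` sets because the root is not counted.
Packing : Subset n → Pred (Subset n) 0ℓ → List ℕ → Set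
Packing A P []       = ⊤
Packing A P (ℓ ∷ ℓs) = Σ (Chain A P (pred ℓ)) λ c → Packing A (λ S → P S × ∀ i → at c i ≢ S) ℓs

packing-map : ∀ {A : Subset n} {P Q} ℓs → (∀ {S} → P S → Q S) → Packing A P ℓs → Packing A Q ℓs
packing-map []       P⊆Q _        = tt
packing-map (ℓ ∷ ℓs) P⊆Q (c , cs) =
  chain-map id P⊆Q c , packing-map ℓs (λ { (PS , S∉c) → P⊆Q PS , S∉c }) cs

module _ {A : Subset n} where
  atNode : ∀ {P} ℓs → Packing A P ℓs → (i : Fin (length ℓs)) → Fin (pred (lookup ℓs i)) → Subset n
  atNode (ℓ ∷ ℓs) (c , cs) zero    = at c
  atNode (ℓ ∷ ℓs) (c , cs) (suc i) = atNode ℓs cs i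

  atNode-member : ∀ {P} ℓs (cs : Packing A P ℓs) i a → P (atNode ℓs cs i a)
  atNode-member (ℓ ∷ ℓs) (c , cs) zero    a = member c a
  atNode-member (ℓ ∷ ℓs) (c , cs) (suc i) a = proj₁ (atNode-member ℓs cs i a)

  atNode-above : ∀ {P} ℓs (cs : Packing A P ℓs) i a → A ⊆ atNode ℓs cs i a
  atNode-above (ℓ ∷ ℓs) (c , cs) zero    a = above c a
  atNode-above (ℓ ∷ ℓs) (c , cs) (suc i) a = atNode-above ℓs cs i a

  atNode-increasing : ∀ {P} ℓs (cs : Packing A P ℓs) i {a b} → a Fin.< b → atNode ℓs cs i a ⊂ atNode ℓs cs i b
  atNode-increasing (ℓ ∷ ℓs) (c , cs) zero    a<b = increasing c a<b
  atNode-increasing (ℓ ∷ ℓs) (c , cs) (suc i) a<b = atNode-increasing ℓs cs i a<b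

  atNode-disjoint : ∀ {P} ℓs (cs : Packing A P ℓs) i j a b → atNode ℓs cs i a ≡ atNode ℓs cs j b → i ≡ j
  atNode-disjoint (ℓ ∷ ℓs) (c , cs) zero    zero    a b _  = refl
  atNode-disjoint (ℓ ∷ ℓs) (c , cs) zero    (suc j) a b eq = ⊥-elim (proj₂ (atNode-member ℓs cs j b) a eq)
  atNode-disjoint (ℓ ∷ ℓs) (c , cs) (suc i) zero    a b eq = ⊥-elim (proj₂ (atNode-member ℓs cs i a) b (sym eq))
  atNode-disjoint (ℓ ∷ ℓs) (c , cs) (suc i) (suc j) a b eq = cong suc (atNode-disjoint ℓs cs i j a b eq)

  -- The root goes to `A` and branch i to the i-th chain: different chains are disjoint, each is
  -- strictly increasing, and none contains `A`.
  packing⇒contains : ∀ {𝓕 : Pred (Subset n) 0ℓ} ℓs → 𝓕 A → Packing A (λ S → 𝓕 S × S ≢ A) ℓs →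
    Contains (fan ℓs) (familyPoset 𝓕)
  packing⇒contains {𝓕} ℓs A∈𝓕 cs =
    (λ v → f v , f-member v) , (λ {u} {v} → f-injective u v) , f-mono
    where
    f : FanCarrier ℓs → Subset n
    f root       = A
    f (node i a) = atNode ℓs cs i a
    f-member : ∀ v → 𝓕 (f v)
    f-member root       = A∈𝓕
    f-member (node i a) = proj₁ (atNode-member ℓs cs i a)
    f-injective : ∀ u v → f u ≡ f v → u ≡ v
    f-injective root       root       _  = refl
    f-injective root       (node j b) eq = ⊥-elim (proj₂ (atNode-member ℓs cs j b) (sym eq))
    f-injective (node i a) root       eq = ⊥-elim (proj₂ (atNode-member ℓs cs i a) eq)
    f-injective (node i a) (node j b) eq with refl ← atNode-disjoint ℓs cs i j a b eq with Fin.<-cmp a b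
    ... | tri< a<b _ _  = ⊥-elim (⊂-irref eq (atNode-increasing ℓs cs i a<b))
    ... | tri≈ _ refl _ = refl
    ... | tri> _ _ b<a  = ⊥-elim (⊂-irref (sym eq) (atNode-increasing ℓs cs i b<a))
    f-mono : ∀ u v → FanLeq ℓs u v → f u ⊆ f v
    f-mono root root root≤ = id
    f-mono root (node i a) root≤ = atNode-above ℓs cs i a
    f-mono (node i a) (node i b) (node≤ a≤b) with Fin.<-cmp a b
    ... | tri< a<b _ _  = p⊂q⇒p⊆q (atNode-increasing ℓs cs i a<b)
    ... | tri≈ _ refl _ = id
    ... | tri> _ _ b<a  = ⊥-elim (<⇒≱ b<a a≤b)

-- Greedy packing and its cost

-- The outcome of a failed attempt to pack chains with ℓ₁ − 1, ℓ₂ − 1, … elements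
-- above a set of corank suc N one after the other: w is the weight of the
-- family, and each chain taken out of it weighs at most N ! per element.
data Stuck (N : ℕ) : ℕ → List ℕ → Set where
  stop : ∀ {w ℓ ℓs} → w + suc N ! ≤ pred ℓ * suc N ! → Stuck N w (ℓ ∷ ℓs)
  next : ∀ {w w′ ℓ ℓs} → pred ℓ ≤ suc N → w ≤ pred ℓ * N ! + w′ → Stuck N w′ ℓs → Stuck N w (ℓ ∷ ℓs)

-- Equivalent to M ≤ binomial(M, p + 1) for M = p + q + 2.
!*!≤ : ∀ p q → suc p ! * suc q ! ≤ suc (p + q) !
!*!≤ zero    q = ≤-reflexive (*-identityˡ (suc q !))
!*!≤ (suc p) q = begin
  suc (suc p) * suc p ! * suc q !       ≡⟨ *-assoc (suc (suc p)) (suc p !) (suc q !) ⟩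
  suc (suc p) * (suc p ! * suc q !)     ≤⟨ *-mono-≤ (s≤s (s≤s (m≤m+n p q))) (!*!≤ p q) ⟩
  suc (suc p + q) * suc (p + q) !       ∎
  where open ≤-Reasoning

-- A set strictly between `A` and [n] lies on at most a fraction 1 / (N + 1) of the (N + 1) !
-- maximal chains, because the inner binomial coefficients of N + 1 are at least N + 1.
chainsVia-≤ : ∀ {A F : Subset n} {N} → ∣ A ∣ + suc N ≡ n → A ≢ F → ∣ F ∣ < n → chainsVia A F ≤ N !
chainsVia-≤ {n} {A} {F} {N} A+N≡n A≢F F<n with A ⊆? F
... | no  _   = z≤n
... | yes A⊆F = begin
  (∣ F ∣ ∸ ∣ A ∣) ! * (n ∸ ∣ F ∣) !  ≡⟨ cong₂ (λ x y → x ! * y !) (<⇒∸≡suc A<F) (<⇒∸≡suc F<n) ⟩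
  suc p ! * suc q !                  ≤⟨ !*!≤ p q ⟩
  suc (p + q) !                      ≡⟨ cong _! 1+p+q≡N ⟩
  N !                                ∎
  where
  open ≤-Reasoning
  A<F = ⊆∧≢⇒< A⊆F A≢F
  p = ∣ F ∣ ∸ suc ∣ A ∣
  q = n ∸ suc ∣ F ∣
  rearrange : ∀ a p q → a + suc (suc (p + q)) ≡ suc (suc a + p) + q
  rearrange = solve-∀
  1+p+q≡N : suc (p + q) ≡ N
  1+p+q≡N = suc-injective (+-cancelˡ-≡ ∣ A ∣ _ _ (trans (rearrange ∣ A ∣ p q)
    (trans (cong (λ x → suc x + q) (m+[n∸m]≡n A<F)) (trans (m+[n∸m]≡n F<n) (sym A+N≡n)))))

-- The summand N ! on the left expresses the factor b - 1 without subtraction; for b = 0 the empty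
-- chain serves.
chain⊎light : ∀ {N A} (𝓕 : List (Subset n)) → Unique 𝓕 → ∣ A ∣ + N ≡ n → ∀ b →
  Chain A (_∈ 𝓕) b ⊎ weight 𝓕 A + N ! ≤ b * N !
chain⊎light 𝓕 𝓕! A+N≡n zero = inj₁ emptyChain
chain⊎light {N = N} {A} 𝓕 𝓕! A+N≡n (suc b) with longChain N 𝓕 A 𝓕! A+N≡n b
... | inj₁ c  = inj₁ c
... | inj₂ w≤ = inj₂ (subst (_≤ suc b * N !) (+-comm (N !) _) (+-monoʳ-≤ (N !) w≤))

-- A chain for `ℓ` is taken out of `𝓖` and the search goes on in the rest. The chain avoids `A` and
-- [n], so it has at most N + 1 sets and each costs at most N !.
greedy : ∀ {N} {A : Subset n} → ∣ A ∣ + suc N ≡ n →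
  ∀ ℓs 𝓖 → Unique 𝓖 → A ∉ 𝓖 → (∀ {S} → S ∈ 𝓖 → ∣ S ∣ < n) →
  Packing A (_∈ 𝓖) ℓs ⊎ Stuck N (weight 𝓖 A) ℓs
greedy A+N≡n [] 𝓖 𝓖! A∉𝓖 𝓖<n = inj₁ tt
greedy {n} {N} {A} A+N≡n (ℓ ∷ ℓs) 𝓖 𝓖! A∉𝓖 𝓖<n with chain⊎light 𝓖 𝓖! A+N≡n (pred ℓ)
... | inj₂ w≤ = inj₂ (stop w≤)
... | inj₁ c with greedy A+N≡n ℓs (𝓖 ∖ tabulate (at c)) (∖-! (tabulate (at c)) 𝓖!)
                    (A∉𝓖 ∘ proj₁ ∘ ∖-∈ 𝓖 _) (𝓖<n ∘ proj₁ ∘ ∖-∈ 𝓖 _)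
...   | inj₁ cs = inj₁ (c , packing-map ℓs outside-c cs)
  where
  outside-c : ∀ {S} → S ∈ 𝓖 ∖ tabulate (at c) → S ∈ 𝓖 × ∀ i → at c i ≢ S
  outside-c S∈ with ∖-∈ 𝓖 (tabulate (at c)) S∈
  ... | S∈𝓖 , S∉c = S∈𝓖 , λ { i refl → S∉c (∈-tabulate⁺ i) }
...   | inj₂ stuck = inj₂ (next (chain-length A+N≡n c A≢c) (begin
  weight 𝓖 A                                         ≤⟨ sum-map-∖ (chainsVia A) 𝓖 (tabulate (at c)) 𝓖! ⟩
  weight (tabulate (at c)) A + w′
    ≤⟨ +-monoˡ-≤ w′ (sum-map-≤-const (chainsVia A) (All.tabulate⁺ λ i → chainsVia-≤ A+N≡n (A≢c i) (𝓖<n (member c i)))) ⟩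
  length (tabulate (at c)) * N ! + w′
    ≡⟨ cong (λ x → x * N ! + w′) (length-tabulate (at c)) ⟩
  pred ℓ * N ! + w′                                  ∎) stuck)
  where
  open ≤-Reasoning
  w′ = weight (𝓖 ∖ tabulate (at c)) A
  A≢c : ∀ i → A ≢ at c i
  A≢c i A≡ = A∉𝓖 (subst (_∈ 𝓖) (sym A≡) (member c i))

-- A removed chain has at most N + 1 sets of weight at most N !, hence costs at most (N + 1) !. The
-- strict drop from one length to the next pays for it.
stuck-strict : ∀ {N w ℓ ℓs} → Linked _>_ (ℓ ∷ ℓs) → All (2 ≤_) ℓs → Stuck N w (ℓ ∷ ℓs) →
  w + suc N ! ≤ pred ℓ * suc N !
stuck-strict _ _ (stop w≤) = w≤
stuck-strict {N} {w} {suc ℓ} {suc ℓ′ ∷ ℓs} (s≤s ℓ′<ℓ ∷ decreasing) (_ ∷ ≥2)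
  (next {w′ = w′} ℓ≤N w≤ stuck) = begin
  w + suc N !                 ≤⟨ +-monoˡ-≤ (suc N !) w≤ ⟩
  ℓ * N ! + w′ + suc N !      ≡⟨ +-assoc (ℓ * N !) w′ _ ⟩
  ℓ * N ! + (w′ + suc N !)    ≤⟨ +-mono-≤ (*-monoˡ-≤ (N !) ℓ≤N) (stuck-strict decreasing ≥2 stuck) ⟩
  suc ℓ′ * suc N !            ≤⟨ *-monoˡ-≤ (suc N !) ℓ′<ℓ ⟩
  ℓ * suc N !                 ∎
  where open ≤-Reasoning

-- The number of elements of the fan other than its root.
fanSize : List ℕ → ℕ
fanSize ℓs = sum (map pred ℓs)

-- Each removed set costs at most N !, at most `fanSize` sets are removed, and the length at which
-- the search stops is at most the first one.
stuck-weak : ∀ {N w ℓ ℓs} → Linked _≥_ (ℓ ∷ ℓs) → Stuck N w (ℓ ∷ ℓs) →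
  w + suc N ! ≤ pred ℓ * suc N ! + fanSize (ℓ ∷ ℓs) * N !
stuck-weak _ (stop w≤) = m≤n⇒m≤n+o _ w≤
stuck-weak {N} {w} {ℓ} {ℓ′ ∷ ℓs} (ℓ≥ℓ′ ∷ decreasing) (next {w′ = w′} _ w≤ stuck) = begin
  w + suc N !                                                   ≤⟨ +-monoˡ-≤ (suc N !) w≤ ⟩
  pred ℓ * N ! + w′ + suc N !                                   ≡⟨ +-assoc (pred ℓ * N !) w′ _ ⟩
  pred ℓ * N ! + (w′ + suc N !)
    ≤⟨ +-monoʳ-≤ (pred ℓ * N !) (stuck-weak decreasing stuck) ⟩
  pred ℓ * N ! + (pred ℓ′ * suc N ! + fanSize (ℓ′ ∷ ℓs) * N !)
    ≤⟨ +-monoʳ-≤ (pred ℓ * N !) (+-monoˡ-≤ (fanSize (ℓ′ ∷ ℓs) * N !) (*-monoˡ-≤ (suc N !) (pred-mono-≤ ℓ≥ℓ′))) ⟩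
  pred ℓ * N ! + (pred ℓ * suc N ! + fanSize (ℓ′ ∷ ℓs) * N !)
    ≡⟨ rearrange (pred ℓ) (fanSize (ℓ′ ∷ ℓs)) (N !) (suc N !) ⟩
  pred ℓ * suc N ! + (pred ℓ + fanSize (ℓ′ ∷ ℓs)) * N !         ∎
  where
  open ≤-Reasoning
  rearrange : ∀ l s k m → l * k + (l * m + s * k) ≡ l * m + (l + s) * k
  rearrange = solve-∀

-- If ℓ₁ > ℓ₂, the slack (ℓ₁ − ℓ₂) * suc N ! absorbs the cost of all removed chains.
stuck-gap : ∀ {N w ℓ₁ ℓ₂ ℓs} → ℓ₁ > ℓ₂ → 1 ≤ ℓ₂ → Linked _≥_ (ℓ₁ ∷ ℓ₂ ∷ ℓs) →
  fanSize (ℓ₁ ∷ ℓ₂ ∷ ℓs) ≤ suc N →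
  Stuck N w (ℓ₁ ∷ ℓ₂ ∷ ℓs) → w + suc N ! ≤ pred ℓ₁ * suc N !
stuck-gap _ _ _ _ (stop w≤) = w≤
stuck-gap {N} {w} {suc ℓ₁} {suc ℓ₂} {ℓs} (s≤s ℓ₁>ℓ₂) _ (_ ∷ decreasing) size≤N
  (next {w′ = w′} _ w≤ stuck) = begin
  w + suc N !                               ≤⟨ +-monoˡ-≤ (suc N !) w≤ ⟩
  ℓ₁ * N ! + w′ + suc N !                   ≡⟨ +-assoc (ℓ₁ * N !) w′ _ ⟩
  ℓ₁ * N ! + (w′ + suc N !)                 ≤⟨ +-monoʳ-≤ (ℓ₁ * N !) (stuck-weak decreasing stuck) ⟩
  ℓ₁ * N ! + (ℓ₂ * suc N ! + s * N !)       ≡⟨ rearrange ℓ₁ s ℓ₂ (N !) (suc N !) ⟩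
  (ℓ₁ + s) * N ! + ℓ₂ * suc N !             ≤⟨ +-monoˡ-≤ (ℓ₂ * suc N !) (*-monoˡ-≤ (N !) size≤N) ⟩
  suc ℓ₂ * suc N !                          ≤⟨ *-monoˡ-≤ (suc N !) ℓ₁>ℓ₂ ⟩
  ℓ₁ * suc N !                              ∎
  where
  open ≤-Reasoning
  s = fanSize (suc ℓ₂ ∷ ℓs)
  rearrange : ∀ l s l′ k m → l * k + (l′ * m + s * k) ≡ (l + s) * k + l′ * m
  rearrange = solve-∀

-- Weight bounds for fan-free families

-- A completed packing would give the fan with root `A`.
free⇒stuck : ∀ {𝓕 : List (Subset n)} {ℓs A N} → Unique 𝓕 → (_∈ 𝓕) isFreeOf fan ℓs → A ∈ 𝓕 →
  ∣ A ∣ + suc N ≡ n → (∀ {S} → S ∈ 𝓕 → ∣ S ∣ < n) → Stuck N (weight (𝓕 ∖ (A ∷ [])) A) ℓs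
free⇒stuck {𝓕 = 𝓕} {ℓs} {A} 𝓕! free A∈𝓕 A+N≡n 𝓕<n
  with greedy A+N≡n ℓs (𝓕 ∖ (A ∷ [])) (∖-! (A ∷ []) 𝓕!) (∉-∖-self 𝓕 A) (𝓕<n ∘ proj₁ ∘ ∖-∈ 𝓕 _)
... | inj₂ stuck = stuck
... | inj₁ cs = ⊥-elim (free (packing⇒contains ℓs A∈𝓕 (packing-map ℓs other cs)))
  where
  other : ∀ {S} → S ∈ 𝓕 ∖ (A ∷ []) → S ∈ 𝓕 × S ≢ A
  other S∈ with ∖-∈ 𝓕 (A ∷ []) S∈
  ... | S∈𝓕 , S∉A = S∈𝓕 , λ { refl → S∉A (here refl) }

-- A member of size at most n - m has corank at least m ≥ 1, so [n] is absent and only coranks from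
-- m on need a bound. The bound is p / q, kept in natural numbers.
weight-bound : ∀ {m p q ℓs} {𝓕 : List (Subset n)} → Unique 𝓕 → (_∈ 𝓕) isFreeOf fan ℓs →
  1 ≤ m → (∀ {S} → S ∈ 𝓕 → ∣ S ∣ + m ≤ n) →
  (∀ {N w} → m ≤ suc N → Stuck N w ℓs → q * (w + suc N !) ≤ p * suc N !) →
  q * weight 𝓕 Subset.⊥ ≤ p * n !
weight-bound {n} {m} {p} {q} {ℓs} {𝓕} 𝓕! free 1≤m 𝓕+m≤n bound =
  averaging {p = p} {q} 𝓕 (λ {A} {N} → local N) Subset.⊥ (cong (_+ n) (∣⊥∣≡0 n))
  where
  open ≤-Reasoning
  𝓕<n : ∀ {S} → S ∈ 𝓕 → ∣ S ∣ < n
  𝓕<n {S} S∈𝓕 = ≤-trans (subst (_≤ ∣ S ∣ + m) (+-comm ∣ S ∣ 1) (+-monoʳ-≤ ∣ S ∣ 1≤m)) (𝓕+m≤n S∈𝓕)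
  local : ∀ N {A} → A ∈ 𝓕 → ∣ A ∣ + N ≡ n → q * weight 𝓕 A ≤ p * N !
  local zero {A} A∈𝓕 A+N≡n = ⊥-elim (<⇒≢ (𝓕<n A∈𝓕) (trans (sym (+-identityʳ ∣ A ∣)) A+N≡n))
  local (suc N) {A} A∈𝓕 A+N≡n = begin
    q * weight 𝓕 A                              ≤⟨ *-monoʳ-≤ q (weight-∖-self 𝓕 𝓕! A+N≡n) ⟩
    q * (suc N ! + weight (𝓕 ∖ (A ∷ [])) A)     ≡⟨ cong (q *_) (+-comm (suc N !) _) ⟩
    q * (weight (𝓕 ∖ (A ∷ [])) A + suc N !)
      ≤⟨ bound (+-cancelˡ-≤ ∣ A ∣ m (suc N) (≤-trans (𝓕+m≤n A∈𝓕) (≤-reflexive (sym A+N≡n))))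
                                                        (free⇒stuck 𝓕! free A∈𝓕 A+N≡n 𝓕<n) ⟩
    p * suc N !                                 ∎

-- If the full set belongs to the family, it extends a chain of ℓ₁ − 2 other sets
-- above the root, so the family without it is free of the fan with ℓ₁ − 1 in place of ℓ₁.
weight-bound-⊤ : ∀ {ℓ ℓs} {𝓕 : List (Subset n)} → Unique 𝓕 → (_∈ 𝓕) isFreeOf fan (suc (suc ℓ) ∷ ℓs) →
  Subset.⊤ ∈ 𝓕 → Linked _>_ (suc ℓ ∷ ℓs) → All (2 ≤_) ℓs →
  1 * weight 𝓕 Subset.⊥ ≤ suc ℓ * n !
weight-bound-⊤ {n} {ℓ} {ℓs} {𝓕} 𝓕! free ⊤∈𝓕 decreasing ≥2 =
  averaging {p = suc ℓ} {1} 𝓕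
    (λ {A} {N} A∈𝓕 A+N≡n → subst (_≤ suc ℓ * N !) (sym (*-identityˡ _)) (local N A∈𝓕 A+N≡n))
    Subset.⊥ (cong (_+ n) (∣⊥∣≡0 n))
  where
  open ≤-Reasoning
  local : ∀ N {A} → A ∈ 𝓕 → ∣ A ∣ + N ≡ n → weight 𝓕 A ≤ suc ℓ * N !
  -- Corank 0 means that `A` is [n] and is alone in its interval.
  local zero {A} A∈𝓕 A+N≡n = begin
    weight 𝓕 A                     ≤⟨ weight-∖-self 𝓕 {A} {0} 𝓕! A+N≡n ⟩
    1 + weight (𝓕 ∖ (A ∷ [])) A
      ≤⟨ +-monoʳ-≤ 1 (subst (_≤ 0) (*-identityˡ _) (covers-bound {p = 0} {1} (𝓕 ∖ (A ∷ [])) A (∉-∖-self 𝓕 A) A+N≡n λ ())) ⟩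
    1 + 0                          ≤⟨ s≤s z≤n ⟩
    suc ℓ * 1                      ∎
  local (suc N) {A} A∈𝓕 A+N≡n with greedy A+N≡n (suc ℓ ∷ ℓs) 𝓖₀ 𝓖₀! A∉𝓖₀ 𝓖₀<n
    where
    𝓖₀ = 𝓕 ∖ (A ∷ []) ∖ (Subset.⊤ ∷ [])
    𝓖₀! = ∖-! (Subset.⊤ ∷ []) (∖-! {𝓕 = 𝓕} (A ∷ []) 𝓕!)
    A∉𝓖₀ : A ∉ 𝓖₀
    A∉𝓖₀ = ∉-∖-self 𝓕 A ∘ proj₁ ∘ ∖-∈ (𝓕 ∖ (A ∷ [])) _
    𝓖₀<n : ∀ {S} → S ∈ 𝓖₀ → ∣ S ∣ < n
    𝓖₀<n {S} S∈ = ≤∧≢⇒< (∣p∣≤n S) λ S≡n → proj₂ (∖-∈ (𝓕 ∖ (A ∷ [])) _ S∈) (here (∣p∣≡n⇒p≡⊤ S≡n))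
  -- Both `A` and [n] lie on all `M` chains. The shortened fan starts with `suc ℓ`, so the rest and
  -- one `M` together are bounded by ℓ * M.
  ... | inj₂ stuck = begin
    weight 𝓕 A                                              ≤⟨ weight-∖-self 𝓕 𝓕! A+N≡n ⟩
    M + weight (𝓕 ∖ (A ∷ [])) A
      ≤⟨ +-monoʳ-≤ M (sum-map-∖ (chainsVia A) (𝓕 ∖ (A ∷ [])) (Subset.⊤ ∷ []) (∖-! {𝓕 = 𝓕} (A ∷ []) 𝓕!)) ⟩
    M + (chainsVia A Subset.⊤ + 0 + w)
      ≡⟨ cong (λ x → M + (x + w)) (trans (+-identityʳ _) via⊤) ⟩
    M + (M + w)                                             ≡⟨ cong (M +_) (+-comm M w) ⟩
    M + (w + M)
      ≤⟨ +-monoʳ-≤ M (stuck-strict decreasing ≥2 stuck) ⟩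
    suc ℓ * M                                               ∎
    where
    M = suc N !
    w = weight (𝓕 ∖ (A ∷ []) ∖ (Subset.⊤ ∷ [])) A
    via⊤ : chainsVia A Subset.⊤ ≡ M
    via⊤ rewrite dec-true (A ⊆? Subset.⊤) ⊆⊤ | ∣⊤∣≡n n | n∸n≡0 n
         | trans (cong (_∸ ∣ A ∣) (sym A+N≡n)) (m+n∸m≡n ∣ A ∣ (suc N)) = *-identityʳ M
  -- Putting [n] at the end of `c` restores the length `suc ℓ`; the other chains were packed without
  -- [n], so they stay disjoint from it.
  ... | inj₁ (c , cs) = ⊥-elim (free (packing⇒contains (suc (suc ℓ) ∷ ℓs) A∈𝓕
      ( snocChain (chain-map id (proj₁ ∘ proper) c) ⊆⊤
          (λ i → ⊆∧≢⇒⊂ ⊆⊤ (proj₂ (proper (member c i)))) (⊤∈𝓕 , ⊤≢A)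
      , packing-map ℓs (λ { {S} (S∈ , S∉c) →
          proj₁ (proper S∈) , snoc-all (_≢ S) (at c) S∉c (proj₂ (proper S∈) ∘ sym) }) cs )))
    where
    proper : ∀ {S} → S ∈ 𝓕 ∖ (A ∷ []) ∖ (Subset.⊤ ∷ []) → (S ∈ 𝓕 × S ≢ A) × S ≢ Subset.⊤
    proper S∈ with ∖-∈ (𝓕 ∖ (A ∷ [])) _ S∈
    ... | S∈′ , S∉⊤ with ∖-∈ 𝓕 _ S∈′
    ...   | S∈𝓕 , S∉A = (S∈𝓕 , λ { refl → S∉A (here refl) }) , λ { refl → S∉⊤ (here refl) }
    A<n : ∣ A ∣ < n
    A<n = subst (∣ A ∣ <_) A+N≡n (m<m+n ∣ A ∣ z<s)
    ⊤≢A : Subset.⊤ ≢ A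
    ⊤≢A refl = <⇒≢ A<n (∣⊤∣≡n n)

-- From chain counts to the Lubell function

-- Normalised division cancels a gcd, so identities are checked on unnormalised rationals, where
-- numerators and denominators compute.
toℚᵘ-/ : ∀ p d .{{_ : NonZero d}} → toℚᵘ (p ℚ./ d) ℚᵘ.≃ p ℚᵘ./ d
toℚᵘ-/ p (suc d) = ℚ.toℚᵘ-fromℚᵘ (mkℚᵘ p d)

fromℕ-+ : ∀ a b → fromℕ a ℚ.+ fromℕ b ≡ fromℕ (a + b)
fromℕ-+ a b = ℚ.toℚᵘ-injective (begin
  toℚᵘ (fromℕ a ℚ.+ fromℕ b)            ≈⟨ ℚ.toℚᵘ-homo-+ (fromℕ a) (fromℕ b) ⟩
  toℚᵘ (fromℕ a) ℚᵘ.+ toℚᵘ (fromℕ b)    ≈⟨ ℚᵘ.+-cong (toℚᵘ-/ (ℤ.+ a) 1) (toℚᵘ-/ (ℤ.+ b) 1) ⟩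
  mkℚᵘ (ℤ.+ a) 0 ℚᵘ.+ mkℚᵘ (ℤ.+ b) 0
    ≈⟨ *≡* (cong (ℤ._* ℤ.1ℤ) (cong₂ ℤ._+_ (ℤ.*-identityʳ (ℤ.+ a)) (ℤ.*-identityʳ (ℤ.+ b)))) ⟩
  mkℚᵘ (ℤ.+ (a + b)) 0                  ≈⟨ toℚᵘ-/ (ℤ.+ (a + b)) 1 ⟨
  toℚᵘ (fromℕ (a + b))                  ∎)
  where open ℚᵘ.≃-Reasoning

fromℕ-* : ∀ a b → fromℕ a ℚ.* fromℕ b ≡ fromℕ (a * b)
fromℕ-* a b = ℚ.toℚᵘ-injective (begin
  toℚᵘ (fromℕ a ℚ.* fromℕ b)            ≈⟨ ℚ.toℚᵘ-homo-* (fromℕ a) (fromℕ b) ⟩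
  toℚᵘ (fromℕ a) ℚᵘ.* toℚᵘ (fromℕ b)    ≈⟨ ℚᵘ.*-cong (toℚᵘ-/ (ℤ.+ a) 1) (toℚᵘ-/ (ℤ.+ b) 1) ⟩
  mkℚᵘ (ℤ.+ a) 0 ℚᵘ.* mkℚᵘ (ℤ.+ b) 0    ≈⟨ *≡* (cong (ℤ._* ℤ.1ℤ) (sym (ℤ.pos-* a b))) ⟩
  mkℚᵘ (ℤ.+ (a * b)) 0                  ≈⟨ toℚᵘ-/ (ℤ.+ (a * b)) 1 ⟨
  toℚᵘ (fromℕ (a * b))                  ∎)
  where open ℚᵘ.≃-Reasoning

fromℕ-mono-≤ : ∀ {a b} → a ≤ b → fromℕ a ℚ.≤ fromℕ b
fromℕ-mono-≤ {a} {b} a≤b = ℚ.toℚᵘ-cancel-≤ (begin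
  toℚᵘ (fromℕ a)    ≃⟨ toℚᵘ-/ (ℤ.+ a) 1 ⟩
  mkℚᵘ (ℤ.+ a) 0    ≤⟨ *≤* (ℤ.*-monoʳ-≤-nonNeg (ℤ.+ 1) (ℤ.+≤+ a≤b)) ⟩
  mkℚᵘ (ℤ.+ b) 0    ≃⟨ toℚᵘ-/ (ℤ.+ b) 1 ⟨
  toℚᵘ (fromℕ b)    ∎)
  where open ℚᵘ.≤-Reasoning

fromℕ-cancel-≤ : ∀ {a b} → fromℕ a ℚ.≤ fromℕ b → a ≤ b
fromℕ-cancel-≤ {a} {b} a≤b
  with ℚᵘ.≤-respʳ-≃ (toℚᵘ-/ (ℤ.+ b) 1) (ℚᵘ.≤-respˡ-≃ (toℚᵘ-/ (ℤ.+ a) 1) (ℚ.toℚᵘ-mono-≤ a≤b))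
... | *≤* a*1≤b*1 = ℤ.drop‿+≤+ (ℤ.*-cancelʳ-≤-pos (ℤ.+ a) (ℤ.+ b) (ℤ.+ 1) a*1≤b*1)

1/*fromℕ : ∀ b c .{{_ : NonZero b}} → (ℤ.+ 1 ℚ./ b) ℚ.* fromℕ (b * c) ≡ fromℕ c
1/*fromℕ b@(suc b-1) c = ℚ.toℚᵘ-injective (begin
  toℚᵘ ((ℤ.+ 1 ℚ./ b) ℚ.* fromℕ (b * c))               ≈⟨ ℚ.toℚᵘ-homo-* (ℤ.+ 1 ℚ./ b) (fromℕ (b * c)) ⟩
  toℚᵘ (ℤ.+ 1 ℚ./ b) ℚᵘ.* toℚᵘ (fromℕ (b * c))
    ≈⟨ ℚᵘ.*-cong (toℚᵘ-/ (ℤ.+ 1) b) (toℚᵘ-/ (ℤ.+ (b * c)) 1) ⟩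
  mkℚᵘ (ℤ.+ 1) b-1 ℚᵘ.* mkℚᵘ (ℤ.+ (b * c)) 0
    ≈⟨ *≡* (trans (ℤ.*-identityʳ _) (trans (ℤ.*-identityˡ _) b*c≡c*[b*1])) ⟩
  mkℚᵘ (ℤ.+ c) 0                                       ≈⟨ toℚᵘ-/ (ℤ.+ c) 1 ⟨
  toℚᵘ (fromℕ c)                                       ∎)
  where
  open ℚᵘ.≃-Reasoning
  b*c≡c*[b*1] : ℤ.+ (b * c) ≡ ℤ.+ c ℤ.* ℤ.+ (b * 1)
  b*c≡c*[b*1] = trans (cong ℤ.+_ (trans (*-comm b c) (cong (c *_) (sym (*-identityʳ b)))))
                      (ℤ.pos-* c (b * 1))

nCk*k!*[n∸k]!≡n! : ∀ {n k} → k ≤ n → (n C k) * (k ! * (n ∸ k) !) ≡ n !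
nCk*k!*[n∸k]!≡n! {n} {k} k≤n = trans (cong (_* (k ! * (n ∸ k) !)) (nCk≡n!/k![n-k]! k≤n))
  (m/n*n≡m {{k !* (n ∸ k) !≢0}} (k![n∸k]!∣n! k≤n))

-- Multiplying 1 / binomial(n, |S|) by n ! gives |S| ! (n - |S|) !, the number of full chains
-- through `S`.
lubell-weight : ∀ (𝓕 : List (Subset n)) → lubell 𝓕 ℚ.* fromℕ (n !) ≡ fromℕ (weight 𝓕 Subset.⊥)
lubell-weight {n} [] = ℚ.*-zeroˡ (fromℕ (n !))
lubell-weight {n} (S ∷ 𝓕) = begin
  (lubellWeight S ℚ.+ lubell 𝓕) ℚ.* fromℕ (n !)
    ≡⟨ ℚ.*-distribʳ-+ (fromℕ (n !)) (lubellWeight S) (lubell 𝓕) ⟩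
  lubellWeight S ℚ.* fromℕ (n !) ℚ.+ lubell 𝓕 ℚ.* fromℕ (n !)
    ≡⟨ cong₂ ℚ._+_ single (lubell-weight 𝓕) ⟩
  fromℕ (chainsVia Subset.⊥ S) ℚ.+ fromℕ (weight 𝓕 Subset.⊥)
    ≡⟨ fromℕ-+ (chainsVia Subset.⊥ S) (weight 𝓕 Subset.⊥) ⟩
  fromℕ (weight (S ∷ 𝓕) Subset.⊥)
    ∎
  where
  open ≡-Reasoning
  single : lubellWeight S ℚ.* fromℕ (n !) ≡ fromℕ (chainsVia Subset.⊥ S)
  single = begin
    lubellWeight S ℚ.* fromℕ (n !)
      ≡⟨ cong (λ m → lubellWeight S ℚ.* fromℕ m) (nCk*k!*[n∸k]!≡n! (∣p∣≤n S)) ⟨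
    lubellWeight S ℚ.* fromℕ ((n C ∣ S ∣) * (∣ S ∣ ! * (n ∸ ∣ S ∣) !))
      ≡⟨ 1/*fromℕ (n C ∣ S ∣) (∣ S ∣ ! * (n ∸ ∣ S ∣) !) {{nCk-nonZero (∣p∣≤n S)}} ⟩
    fromℕ (∣ S ∣ ! * (n ∸ ∣ S ∣) !)
      ≡⟨ cong fromℕ (chainsVia-⊥ S) ⟨
    fromℕ (chainsVia Subset.⊥ S)
      ∎

fromℕ-pos : ∀ a .{{_ : NonZero a}} → ℚ.Positive (fromℕ a)
fromℕ-pos a = ℚ.normalize-pos a 1

fromℕ-nonNeg : ∀ a → ℚ.NonNegative (fromℕ a)
fromℕ-nonNeg a = ℚ.normalize-nonNeg a 1

lubell-≤ : ∀ {p q} (𝓕 : List (Subset n)) → q * weight 𝓕 Subset.⊥ ≤ p * n ! → fromℕ q ℚ.* lubell 𝓕 ℚ.≤ fromℕ p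
lubell-≤ {n} {p} {q} 𝓕 bound = ℚ.*-cancelʳ-≤-pos (fromℕ (n !)) {{fromℕ-pos (n !) {{n !≢0}}}} (begin
  fromℕ q ℚ.* lubell 𝓕 ℚ.* fromℕ (n !)     ≡⟨ ℚ.*-assoc (fromℕ q) (lubell 𝓕) (fromℕ (n !)) ⟩
  fromℕ q ℚ.* (lubell 𝓕 ℚ.* fromℕ (n !))   ≡⟨ cong (fromℕ q ℚ.*_) (lubell-weight 𝓕) ⟩
  fromℕ q ℚ.* fromℕ (weight 𝓕 Subset.⊥)    ≡⟨ fromℕ-* q (weight 𝓕 Subset.⊥) ⟩
  fromℕ (q * weight 𝓕 Subset.⊥)            ≤⟨ fromℕ-mono-≤ bound ⟩
  fromℕ (p * n !)                          ≡⟨ fromℕ-* p (n !) ⟨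
  fromℕ p ℚ.* fromℕ (n !)                  ∎)
  where open ℚ.≤-Reasoning

lubell-≤⁻ : ∀ {p} (𝓕 : List (Subset n)) → lubell 𝓕 ℚ.≤ fromℕ p → weight 𝓕 Subset.⊥ ≤ p * n !
lubell-≤⁻ {n} {p} 𝓕 bound = fromℕ-cancel-≤ (begin
  fromℕ (weight 𝓕 Subset.⊥)   ≡⟨ lubell-weight 𝓕 ⟨
  lubell 𝓕 ℚ.* fromℕ (n !)    ≤⟨ ℚ.*-monoʳ-≤-nonNeg (fromℕ (n !)) {{fromℕ-nonNeg (n !)}} bound ⟩
  fromℕ p ℚ.* fromℕ (n !)     ≡⟨ fromℕ-* p (n !) ⟩
  fromℕ (p * n !)             ∎)
  where open ℚ.≤-Reasoning

-- The value of e for a fan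

-- Injectivity makes the inclusions along branch `i` strict, so each step adds at least one element.
contains⇒size : ∀ {ℓs} {𝓕 : Pred (Subset n) 0ℓ} ((f , _) : Contains (fan ℓs) (familyPoset 𝓕)) →
  ∀ i a → suc ∣ proj₁ (f root) ∣ + toℕ a ≤ ∣ proj₁ (f (node i a)) ∣
contains⇒size {ℓs = ℓs} (f , f-injective , f-mono) i = increasing⇒≥ (λ a → ∣ proj₁ (f (node i a)) ∣)
  (λ a<b → ⊆∧≢⇒< (f-mono _ _ (node≤ (<⇒≤ a<b))) (distinct a<b ∘ f-injective))
  (λ a → ⊆∧≢⇒< (f-mono _ _ root≤) (root≢node ∘ f-injective))
  where
  distinct : ∀ {a b} → a Fin.< b → node {ℓs} i a ≢ node i b
  distinct a<b refl = <-irrefl refl a<b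
  root≢node : ∀ {a} → root ≢ node {ℓs} i a
  root≢node ()

-- The first branch with the root takes ℓ₁ distinct sizes, but only ℓ₁ - 1 are available.
levels-free : ∀ ℓ ℓs → LevelsFree (fan (suc (suc ℓ) ∷ ℓs)) (suc ℓ)
levels-free ℓ ℓs n s c@(f , _) = ℤ.<-irrefl refl (begin-strict
  ℤ.+ ∣ T ∣                    <⟨ proj₂ (proj₂ (f (node zero (Fin.fromℕ ℓ)))) ⟩
  s ℤ.+ ℤ.+ suc ℓ              ≤⟨ ℤ.+-monoˡ-≤ (ℤ.+ suc ℓ) (proj₁ (proj₂ (f root))) ⟩
  ℤ.+ (∣ R ∣ + suc ℓ)
    ≡⟨ cong ℤ.+_ (trans (+-suc ∣ R ∣ ℓ) (cong (suc ∣ R ∣ +_) (sym (Fin.toℕ-fromℕ ℓ)))) ⟩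
  ℤ.+ (suc ∣ R ∣ + toℕ (Fin.fromℕ ℓ)) ≤⟨ ℤ.+≤+ (contains⇒size c zero (Fin.fromℕ ℓ)) ⟩
  ℤ.+ ∣ T ∣                    ∎)
  where
  open ℤ.≤-Reasoning
  R = proj₁ (f root)
  T = proj₁ (f (node zero (Fin.fromℕ ℓ)))

∣p∪q∣≤∣p∣+∣q∣ : ∀ (p q : Subset n) → ∣ p ∪ q ∣ ≤ ∣ p ∣ + ∣ q ∣
∣p∪q∣≤∣p∣+∣q∣ []            []            = z≤n
∣p∪q∣≤∣p∣+∣q∣ (inside ∷ p)  (inside ∷ q)  = s≤s (≤-trans (∣p∪q∣≤∣p∣+∣q∣ p q) (+-monoʳ-≤ ∣ p ∣ (n≤1+n ∣ q ∣)))
∣p∪q∣≤∣p∣+∣q∣ (inside ∷ p)  (outside ∷ q) = s≤s (∣p∪q∣≤∣p∣+∣q∣ p q)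
∣p∪q∣≤∣p∣+∣q∣ (outside ∷ p) (inside ∷ q)  =
  ≤-trans (s≤s (∣p∪q∣≤∣p∣+∣q∣ p q)) (≤-reflexive (sym (+-suc ∣ p ∣ ∣ q ∣)))
∣p∪q∣≤∣p∣+∣q∣ (outside ∷ p) (outside ∷ q) = ∣p∪q∣≤∣p∣+∣q∣ p q

-- The set {x 0, ..., x a}.
segment : ∀ {b} → (Fin b → Fin n) → Fin b → Subset n
segment x zero    = ⁅ x zero ⁆
segment x (suc a) = ⁅ x zero ⁆ ∪ segment (x ∘ suc) a

segment-size : ∀ {b} (x : Fin b → Fin n) a → ∣ segment x a ∣ ≤ suc (toℕ a)
segment-size x zero    = ≤-reflexive (∣⁅x⁆∣≡1 (x zero))
segment-size x (suc a) = ≤-trans (∣p∪q∣≤∣p∣+∣q∣ ⁅ x zero ⁆ _)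
  (+-mono-≤ (≤-reflexive (∣⁅x⁆∣≡1 (x zero))) (segment-size (x ∘ suc) a))

∈-segment⁺ : ∀ {b} (x : Fin b → Fin n) {j a} → j Fin.≤ a → x j Subset.∈ segment x a
∈-segment⁺ x {zero}  {zero}  _   = x∈⁅x⁆ (x zero)
∈-segment⁺ x {zero}  {suc a} _   = x∈p∪q⁺ (inj₁ (x∈⁅x⁆ (x zero)))
∈-segment⁺ x {suc j} {suc a} j≤a = x∈p∪q⁺ (inj₂ (∈-segment⁺ (x ∘ suc) (s≤s⁻¹ j≤a)))

∈-segment⁻ : ∀ {b} (x : Fin b → Fin n) a {y} → y Subset.∈ segment x a → ∃ λ j → j Fin.≤ a × y ≡ x j
∈-segment⁻ x zero    y∈ = zero , z≤n , x∈⁅y⁆⇒x≡y (x zero) y∈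
∈-segment⁻ x (suc a) y∈ with x∈p∪q⁻ ⁅ x zero ⁆ (segment (x ∘ suc) a) y∈
... | inj₁ y∈ = zero , z≤n , x∈⁅y⁆⇒x≡y (x zero) y∈
... | inj₂ y∈ with j , j≤a , y≡ ← ∈-segment⁻ (x ∘ suc) a y∈ = suc j , s≤s j≤a , y≡

-- Chain i grows through its own block of elements combine i 0, combine i 1, ….
levels-contain : ∀ {ℓs h k} → (∀ i → pred (lookup ℓs i) ≤ h) → h < k →
  Contains (fan ℓs) (familyPoset (levels (length ℓs * h) (ℤ.+ 0) k))
levels-contain {ℓs} {h} {k} ≤h h<k =
  (λ v → f v , ℤ.+≤+ z≤n , ℤ.+<+ (f-size v)) , (λ {u} {v} → f-injective u v) , f-mono
  where
  x : ∀ i → Fin (pred (lookup ℓs i)) → Fin (length ℓs * h)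
  x i a = combine i (inject≤ a (≤h i))

  x-injective : ∀ {i j a b} → x i a ≡ x j b → node {ℓs} i a ≡ node j b
  x-injective {i} {j} {a} {b} eq with Fin.combine-injective i (inject≤ a (≤h i)) j (inject≤ b (≤h j)) eq
  ... | refl , a≡b = cong (node i) (Fin.inject≤-injective _ _ a b a≡b)

  f : FanCarrier ℓs → Subset (length ℓs * h)
  f root       = Subset.⊥
  f (node i a) = segment (x i) a

  f-size : ∀ v → ∣ f v ∣ < k
  f-size root       = subst (_< k) (sym (∣⊥∣≡0 (length ℓs * h))) (≤-trans (s≤s z≤n) h<k)
  f-size (node i a) = ≤-<-trans (segment-size (x i) a) (≤-<-trans (≤-trans (Fin.toℕ<n a) (≤h i)) h<k)

  f-⊆⇒≤ : ∀ i j a b → f (node i a) ⊆ f (node j b) → FanLeq ℓs (node i a) (node j b)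
  -- The last element `x i a` of the smaller set lies in the larger one; as `x` is injective across
  -- blocks, this fixes the branch and gives the order.
  f-⊆⇒≤ i j a b ⊆ with c , c≤b , eq ← ∈-segment⁻ (x j) b (⊆ (∈-segment⁺ (x i) {a} ≤-refl))
    with refl ← x-injective eq = node≤ c≤b

  f-injective : ∀ u v → f u ≡ f v → u ≡ v
  f-injective root       root       _  = refl
  f-injective root       (node j b) eq = ⊥-elim (∉⊥ (subst (x j b Subset.∈_) (sym eq) (∈-segment⁺ (x j) {b} ≤-refl)))
  f-injective (node i a) root       eq = ⊥-elim (∉⊥ (subst (x i a Subset.∈_) eq (∈-segment⁺ (x i) {a} ≤-refl)))
  f-injective (node i a) (node j b) eq =
    antisym (f-⊆⇒≤ i j a b (⊆-reflexive eq)) (f-⊆⇒≤ j i b a (⊆-reflexive (sym eq)))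
    where open Poset (fan ℓs) using (antisym)

  f-mono : ∀ u v → FanLeq ℓs u v → f u ⊆ f v
  f-mono root       v          root≤       = ⊥⊆
  f-mono (node i a) (node i b) (node≤ a≤b) y∈ with j , j≤a , refl ← ∈-segment⁻ (x i) a y∈ =
    ∈-segment⁺ (x i) (≤-trans j≤a a≤b)

-- With ℓ₁ or more levels from size 0 up all branches fit, since none has more than ℓ₁ - 1 elements
-- besides the root.
isE-fan : ∀ ℓ {ℓs} → Linked _≥_ (suc (suc ℓ) ∷ ℓs) → IsE (fan (suc (suc ℓ) ∷ ℓs)) (suc ℓ)
isE-fan ℓ {ℓs} decreasing = levels-free ℓ ℓs , λ k free → ≮⇒≥ λ ℓ<k →
  free _ _ (levels-contain (λ i → pred-mono-≤ (All.lookup ≤ℓ₁ (∈-lookup i))) ℓ<k)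
  where
  ≤ℓ₁ : All (suc (suc ℓ) ≥_) (suc (suc ℓ) ∷ ℓs)
  ≤ℓ₁ = Linked⇒All (λ p q → ≤-trans q p) ≤-refl decreasing

-- Full levels and the failure of L-boundedness

-- The recursion follows Pascal's rule, which makes the length a binomial coefficient.
sized : ∀ (n k : ℕ) → List (Subset n)
sized zero    zero    = [] ∷ []
sized zero    (suc k) = []
sized (suc n) zero    = map (outside ∷_) (sized n zero)
sized (suc n) (suc k) = map (inside ∷_) (sized n k) ++ map (outside ∷_) (sized n (suc k))

length-sized : ∀ (n k : ℕ) → length (sized n k) ≡ n C k
length-sized zero    zero    = refl
length-sized zero    (suc k) = refl
length-sized (suc n) zero    = trans (length-map _ (sized n zero)) (length-sized n zero)
length-sized (suc n) (suc k) = trans (length-++ (map (inside ∷_) (sized n k)))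
  (trans (cong₂ _+_ (trans (length-map _ (sized n k)) (length-sized n k))
                    (trans (length-map _ (sized n (suc k))) (length-sized n (suc k))))
         (nCk+nC[k+1]≡[n+1]C[k+1] n k))

sized-size : ∀ (n k : ℕ) → All (λ S → ∣ S ∣ ≡ k) (sized n k)
sized-size zero    zero    = refl ∷ []
sized-size zero    (suc k) = []
sized-size (suc n) zero    = All.map⁺ (sized-size n zero)
sized-size (suc n) (suc k) =
  All.++⁺ (All.map⁺ (All.map (cong suc) (sized-size n k))) (All.map⁺ (sized-size n (suc k)))

sized-! : ∀ (n k : ℕ) → Unique (sized n k)
sized-! zero    zero    = [] ∷ []
sized-! zero    (suc k) = []
sized-! (suc n) zero    = Unique.map⁺ Vec.∷-injectiveʳ (sized-! n zero)
sized-! (suc n) (suc k) = Unique.++⁺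
  (Unique.map⁺ Vec.∷-injectiveʳ (sized-! n k)) (Unique.map⁺ Vec.∷-injectiveʳ (sized-! n (suc k)))
  λ (S∈in , S∈out) → disjoint (∈-map⁻ _ S∈in) (∈-map⁻ _ S∈out)
  where
  disjoint : ∀ {S : Subset (suc n)} → (∃ λ T → T ∈ sized n k × S ≡ inside ∷ T) →
             (∃ λ T → T ∈ sized n (suc k) × S ≡ outside ∷ T) → Data.Empty.⊥
  disjoint (_ , _ , refl) (_ , _ , ())

sum-map-const : ∀ (f : I → ℕ) {k xs} → All (λ x → f x ≡ k) xs → sum (map f xs) ≡ length xs * k
sum-map-const f [] = refl
sum-map-const f (fx≡k ∷ f≡k) = cong₂ _+_ fx≡k (sum-map-const f f≡k)

-- Every full chain meets the level exactly once.
weight-sized : ∀ {n k} → k ≤ n → weight (sized n k) Subset.⊥ ≡ n !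
weight-sized {n} {k} k≤n = begin
  weight (sized n k) Subset.⊥
    ≡⟨ sum-map-const (chainsVia Subset.⊥) (All.map (λ {S} → via S) (sized-size n k)) ⟩
  length (sized n k) * (k ! * (n ∸ k) !)    ≡⟨ cong (_* (k ! * (n ∸ k) !)) (length-sized n k) ⟩
  (n C k) * (k ! * (n ∸ k) !)               ≡⟨ nCk*k!*[n∸k]!≡n! k≤n ⟩
  n !                                       ∎
  where
  open ≡-Reasoning
  via : ∀ S → ∣ S ∣ ≡ k → chainsVia Subset.⊥ S ≡ k ! * (n ∸ k) !
  via S S≡k = trans (chainsVia-⊥ S) (cong (λ s → s ! * (n ∸ s) !) S≡k)

consecutive : ∀ n (m j : ℕ) → List (Subset n)
consecutive n m zero    = []
consecutive n m (suc j) = sized n (m + j) ++ consecutive n m j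

consecutive-size : ∀ m j {S} → S ∈ consecutive n m j → m ≤ ∣ S ∣ × ∣ S ∣ < m + j
consecutive-size {n} m (suc j) S∈ with ∈-++⁻ (sized n (m + j)) S∈
... | inj₁ S∈ rewrite All.lookup (sized-size n (m + j)) S∈ = m≤m+n m j , ≤-reflexive (sym (+-suc m j))
... | inj₂ S∈ with m≤S , S<m+j ← consecutive-size m j S∈ = m≤S , ≤-trans S<m+j (+-monoʳ-≤ m (n≤1+n j))

consecutive-! : ∀ n m j → Unique (consecutive n m j)
consecutive-! n m zero    = []
consecutive-! n m (suc j) = Unique.++⁺ (sized-! n (m + j)) (consecutive-! n m j)
  λ (S∈ , S∈′) → <⇒≢ (proj₂ (consecutive-size m j S∈′)) (All.lookup (sized-size n (m + j)) S∈)

weight-consecutive : ∀ n m j → m + j ≤ n → weight (consecutive n m j) Subset.⊥ ≡ j * n !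
weight-consecutive n m zero    _      = refl
weight-consecutive n m (suc j) m+j≤n = begin
  sum (map via (sized n (m + j) ++ consecutive n m j))
    ≡⟨ cong sum (map-++ via (sized n (m + j)) _) ⟩
  sum (map via (sized n (m + j)) ++ map via (consecutive n m j))
    ≡⟨ sum-++ (map via (sized n (m + j))) _ ⟩
  weight (sized n (m + j)) Subset.⊥ + weight (consecutive n m j) Subset.⊥
    ≡⟨ cong₂ _+_ (weight-sized m+j′≤n) (weight-consecutive n m j m+j′≤n) ⟩
  n ! + j * n !                                                        ∎
  where
  open ≡-Reasoning
  via = chainsVia Subset.⊥
  m+j′≤n : m + j ≤ n
  m+j′≤n = ≤-trans (+-monoʳ-≤ m (n≤1+n j)) m+j≤n

subsetOfSize : ∀ k m → ∃ λ (T : Subset (k + m)) → ∣ T ∣ ≡ k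
subsetOfSize zero    m = Subset.⊥ , ∣⊥∣≡0 m
subsetOfSize (suc k) m with T , T≡k ← subsetOfSize k m = inside ∷ T , cong suc T≡k

-- ℓ₁ − 1 full levels together with one further set T above them: the two longest
-- chains of the fan would both have to end in T.
twoLongest⇒¬bounded : ∀ ℓ {ℓs} → Linked _≥_ (suc (suc ℓ) ∷ suc (suc ℓ) ∷ ℓs) →
  ¬ IsLBounded (fan (suc (suc ℓ) ∷ suc (suc ℓ) ∷ ℓs))
twoLongest⇒¬bounded ℓ {ℓs} decreasing (m , e , isE , bound) = <⇒≱ heavy (begin
  weight 𝓕 Subset.⊥   ≤⟨ lubell-≤⁻ {p = e} 𝓕 (bound N 𝓕 𝓕! inRange free) ⟩
  -- By the maximality in `isE-fan`, the constant `e` of the supposed bound is at most `j`.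
  e * N !             ≤⟨ *-monoˡ-≤ (N !) (proj₂ (isE-fan ℓ decreasing) e (proj₁ isE)) ⟩
  j * N !             ∎)
  where
  open ≤-Reasoning
  j = suc ℓ
  -- The allowed sizes are then m, ..., m + j: the first j for full levels and the largest for `T`.
  N = m + j + m
  T : Subset N
  T = proj₁ (subsetOfSize (m + j) m)
  T≡ : ∣ T ∣ ≡ m + j
  T≡ = proj₂ (subsetOfSize (m + j) m)
  𝓕 : List (Subset N)
  𝓕 = T ∷ consecutive N m j
  𝓕! : Unique 𝓕
  𝓕! = All.tabulate (λ S∈ T≡S → <⇒≢ (proj₂ (consecutive-size m j S∈)) (trans (cong ∣_∣ (sym T≡S)) T≡))
     ∷ consecutive-! N m j
  inRange : ∀ S → S ∈ 𝓕 → m ≤ ∣ S ∣ × ∣ S ∣ + m ≤ N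
  inRange S (here refl) = subst (m ≤_) (sym T≡) (m≤m+n m j) , +-monoˡ-≤ m (≤-reflexive T≡)
  inRange S (there S∈) with m≤S , S<m+j ← consecutive-size m j S∈ = m≤S , +-monoˡ-≤ m (<⇒≤ S<m+j)
  T>0 : 0 < chainsVia Subset.⊥ T
  T>0 = subst (0 <_) (sym (chainsVia-⊥ T)) (>-nonZero⁻¹ _ {{∣ T ∣ !* (N ∸ ∣ T ∣) !≢0}})
  heavy : j * N ! < weight 𝓕 Subset.⊥
  heavy = begin-strict
    j * N !                                           ≡⟨ weight-consecutive N m j (m≤m+n (m + j) m) ⟨
    weight (consecutive N m j) Subset.⊥               <⟨ m<n+m _ T>0 ⟩
    weight 𝓕 Subset.⊥                                 ∎
  free : (_∈ 𝓕) isFreeOf fan (suc (suc ℓ) ∷ suc (suc ℓ) ∷ ℓs)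
  free c@(f , f-injective , _) =
    case f-injective (trans (top zero last T₁≥) (sym (top (suc zero) last T₂≥))) of λ ()
    where
    last = Fin.fromℕ ℓ
    -- A root of size at least m pushes the end of a longest branch up to size m + j, where `T` is
    -- the only member.
    enough : ∀ {t} → suc ∣ proj₁ (f root) ∣ + toℕ last ≤ t → m + j ≤ t
    enough {t} le = begin
      m + suc ℓ                             ≡⟨ +-suc m ℓ ⟩
      suc m + ℓ                             ≤⟨ +-monoˡ-≤ ℓ (s≤s (proj₁ (inRange _ (proj₂ (f root))))) ⟩
      suc ∣ proj₁ (f root) ∣ + ℓ            ≡⟨ cong (suc ∣ proj₁ (f root) ∣ +_) (Fin.toℕ-fromℕ ℓ) ⟨
      suc ∣ proj₁ (f root) ∣ + toℕ last     ≤⟨ le ⟩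
      t                                     ∎
    T₁≥ = enough (contains⇒size c zero last)
    T₂≥ = enough (contains⇒size c (suc zero) last)
    top : ∀ i a → m + j ≤ ∣ proj₁ (f (node i a)) ∣ → proj₁ (f (node i a)) ≡ T
    top i a ≥m+j with f (node i a)
    ... | _ , here refl = refl
    ... | _ , there S∈  = ⊥-elim (<⇒≱ (proj₂ (consecutive-size m j S∈)) ≥m+j)

-- The three kinds of boundedness

lubell-≤-ℕ : ∀ {p} (𝓕 : List (Subset n)) → 1 * weight 𝓕 Subset.⊥ ≤ p * n ! → lubell 𝓕 ℚ.≤ fromℕ p
lubell-≤-ℕ {p = p} 𝓕 bound = subst (ℚ._≤ fromℕ p) (ℚ.*-identityˡ (lubell 𝓕)) (lubell-≤ {p = p} {1} 𝓕 bound)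

bounded : ∀ {m ℓ ℓs} → Linked _≥_ (suc (suc ℓ) ∷ ℓs) → 1 ≤ m →
  (∀ {N w} → m ≤ suc N → Stuck N w (suc (suc ℓ) ∷ ℓs) → w + suc N ! ≤ suc ℓ * suc N !) →
  IsLBoundedAt (fan (suc (suc ℓ) ∷ ℓs)) m
bounded {m} {ℓ} decreasing 1≤m stuck-bound = suc ℓ , isE-fan ℓ decreasing , λ n 𝓕 𝓕! range free →
  lubell-≤-ℕ {p = suc ℓ} 𝓕 (weight-bound {p = suc ℓ} {1} 𝓕! free 1≤m (proj₂ ∘ range _)
    λ {N} {w} m≤ stuck → subst (_≤ suc ℓ * suc N !) (sym (*-identityˡ (w + suc N !))) (stuck-bound m≤ stuck))

uniformlyBounded : ∀ {ℓ ℓs} → Linked _≥_ (suc (suc ℓ) ∷ ℓs) → All (2 ≤_) ℓs → Linked _>_ (suc ℓ ∷ ℓs) →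
  IsUniformlyLBounded (fan (suc (suc ℓ) ∷ ℓs))
uniformlyBounded {ℓ} {ℓs} decreasing ≥2 strict = suc ℓ , isE-fan ℓ decreasing , bound
  where
  raise : Linked _>_ (suc ℓ ∷ ℓs) → Linked _>_ (suc (suc ℓ) ∷ ℓs)
  raise [-]      = [-]
  raise (p ∷ ps) = m≤n⇒m≤1+n p ∷ ps
  bound : ∀ n (𝓕 : List (Subset n)) → _
  -- If [n] is absent, all sizes are at most n - 1 and the argument for the central case applies.
  bound n 𝓕 𝓕! _ free with Subset.⊤ ∈? 𝓕
  ... | yes ⊤∈𝓕 = lubell-≤-ℕ {p = suc ℓ} 𝓕 (weight-bound-⊤ 𝓕! free ⊤∈𝓕 strict ≥2)
  ... | no  ⊤∉𝓕 = lubell-≤-ℕ {p = suc ℓ} 𝓕 (weight-bound {p = suc ℓ} {1} 𝓕! free ≤-refl 𝓕+1≤n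
    λ {N} {w} _ stuck → subst (_≤ suc ℓ * suc N !) (sym (*-identityˡ (w + suc N !)))
                          (stuck-strict (raise strict) ≥2 stuck))
    where
    𝓕+1≤n : ∀ {S} → S ∈ 𝓕 → ∣ S ∣ + 1 ≤ n
    𝓕+1≤n {S} S∈𝓕 = subst (_≤ n) (+-comm 1 ∣ S ∣)
      (≤∧≢⇒< (∣p∣≤n S) λ S≡n → ⊤∉𝓕 (subst (_∈ 𝓕) (∣p∣≡n⇒p≡⊤ S≡n) S∈𝓕))

archimedean : ∀ s ε → 0ℚ ℚ.< ε → ∃ λ D → 1 ≤ D × fromℕ s ℚ.≤ fromℕ D ℚ.* ε
archimedean s (mkℚ (ℤ.+ zero)  d-1 _) (ℚ.*<* (ℤ.+<+ ()))
archimedean s (mkℚ (-[1+ _ ]) d-1 _) (ℚ.*<* ())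
archimedean s ε@(mkℚ +[1+ p ] d-1 _) _ = D , s≤s z≤n , ℚ.toℚᵘ-cancel-≤ (begin
  toℚᵘ (fromℕ s)              ≃⟨ toℚᵘ-/ (ℤ.+ s) 1 ⟩
  mkℚᵘ (ℤ.+ s) 0
    ≤⟨ *≤* (subst₂ ℤ._≤_ (ℤ.pos-* s (1 * d)) (ℤ.pos-* (D * suc p) 1) (ℤ.+≤+ s*d≤D*p)) ⟩
  mkℚᵘ (ℤ.+ (D * suc p)) (d-1 + 0)  ≃⟨ *≡* (cong (ℤ._* ℤ.+ (1 * d)) (ℤ.pos-* D (suc p))) ⟩
  mkℚᵘ (ℤ.+ D) 0 ℚᵘ.* toℚᵘ ε  ≃⟨ ℚᵘ.*-congʳ {toℚᵘ ε} (toℚᵘ-/ (ℤ.+ D) 1) ⟨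
  toℚᵘ (fromℕ D) ℚᵘ.* toℚᵘ ε  ≃⟨ ℚ.toℚᵘ-homo-* (fromℕ D) ε ⟨
  toℚᵘ (fromℕ D ℚ.* ε)        ∎)
  where
  open ℚᵘ.≤-Reasoning
  d = suc d-1
  -- As ε = (p + 1) / d is at least 1 / d, already s * d copies of it reach `s`; the successor makes
  -- `D` positive.
  D = suc (s * d)
  s*d≤D*p : s * (1 * d) ≤ D * suc p * 1
  s*d≤D*p = ≤-trans (≤-reflexive (cong (s *_) (*-identityˡ d)))
    (≤-trans (n≤1+n (s * d)) (≤-trans (m≤m*n D (suc p)) (≤-reflexive (sym (*-identityʳ _)))))

-- For β = b / d < 1 the numerator is at most d - 1, so a set of size below β n has corank at least
-- n / d.
<β⇒corank : ∀ β → β ℚ.< 1ℚ → ∃ λ d → ∀ a {n D} → fromℕ a ℚ.< β ℚ.* fromℕ n → D * d ≤ n → a + D ≤ n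
<β⇒corank β@(mkℚ b d-1 _) (ℚ.*<* b*1<1*d) = d , λ a {n} {D} a<βn D*d≤n →
  *-cancelʳ-≤ (a + D) n d (begin
    (a + D) * d       ≡⟨ *-distribʳ-+ d a D ⟩
    a * d + D * d     ≤⟨ +-monoʳ-≤ (a * d) D*d≤n ⟩
    a * d + n         ≤⟨ corank a a<βn ⟩
    d * n             ≡⟨ *-comm d n ⟩
    n * d             ∎)
  where
  open ≤-Reasoning
  d = suc d-1
  b≤d-1 : b ℤ.≤ ℤ.+ d-1
  b≤d-1 = ℤ.i<j⇒i≤pred[j] (subst₂ ℤ._<_ (ℤ.*-identityʳ b) (ℤ.*-identityˡ (ℤ.+ d)) b*1<1*d)
  corank : ∀ a {n} → fromℕ a ℚ.< β ℚ.* fromℕ n → a * d + n ≤ d * n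
  corank a {n} a<βn
    with ℚᵘ.<-respʳ-≃ (ℚᵘ.≃-trans (ℚ.toℚᵘ-homo-* β (fromℕ n)) (ℚᵘ.*-congˡ {toℚᵘ β} (toℚᵘ-/ (ℤ.+ n) 1)))
           (ℚᵘ.<-respˡ-≃ (toℚᵘ-/ (ℤ.+ a) 1) (ℚ.toℚᵘ-mono-< a<βn))
  ... | *<* a*[d*1]<b*n*1 = begin
    a * d + n        ≤⟨ +-monoˡ-≤ n (<⇒≤ (ℤ.drop‿+<+ a*d<[d-1]*n)) ⟩
    d-1 * n + n      ≡⟨ +-comm (d-1 * n) n ⟩
    d * n            ∎
    where
    a*d<[d-1]*n : ℤ.+ (a * d) ℤ.< ℤ.+ (d-1 * n)
    a*d<[d-1]*n = ℤ.<-≤-trans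
      (subst₂ ℤ._<_ (trans (sym (ℤ.pos-* a (d * 1))) (cong (λ x → ℤ.+ (a * x)) (*-identityʳ d)))
                    (ℤ.*-identityʳ (b ℤ.* ℤ.+ n)) a*[d*1]<b*n*1)
      (ℤ.≤-trans (ℤ.*-monoʳ-≤-nonNeg (ℤ.+ n) b≤d-1) (ℤ.≤-reflexive (sym (ℤ.pos-* d-1 n))))

-- In corank N + 1 ≥ D the removed sets cost at most s / (N + 1) ≤ s / D ≤ ε on average. Everything
-- is multiplied by `D` to stay in natural numbers.
lowerBounded : ∀ {ℓ ℓs} → Linked _≥_ (suc (suc ℓ) ∷ ℓs) → IsLowerLBounded (fan (suc (suc ℓ) ∷ ℓs))
lowerBounded {ℓ} {ℓs} decreasing = suc ℓ , isE-fan ℓ decreasing , bound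
  where
  s = fanSize (suc (suc ℓ) ∷ ℓs)
  bound : (β ε : ℚ) → ½ ℚ.< β → β ℚ.< 1ℚ → 0ℚ ℚ.< ε → _
  bound β ε _ β<1 0<ε with D , 1≤D , s≤D*ε ← archimedean s ε 0<ε | d , corank ← <β⇒corank β β<1 =
    -- From n = D * d on, every member has corank at least `D`.
    D * d , λ n D*d≤n 𝓕 𝓕! small free →
      ℚ.*-cancelˡ-≤-pos (fromℕ D) {{fromℕ-pos D {{>-nonZero 1≤D}}}} (begin
        fromℕ D ℚ.* lubell 𝓕
          ≤⟨ lubell-≤ {p = D * suc ℓ + s} {D} 𝓕 (weight-bound {p = D * suc ℓ + s} {D} 𝓕! free 1≤D
               (λ {S} S∈𝓕 → corank ∣ S ∣ (small S S∈𝓕) D*d≤n) stuck-bound) ⟩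
        fromℕ (D * suc ℓ + s)
          ≡⟨ fromℕ-+ (D * suc ℓ) s ⟨
        fromℕ (D * suc ℓ) ℚ.+ fromℕ s
          ≡⟨ cong (ℚ._+ fromℕ s) (fromℕ-* D (suc ℓ)) ⟨
        fromℕ D ℚ.* fromℕ (suc ℓ) ℚ.+ fromℕ s
          ≤⟨ ℚ.+-monoʳ-≤ (fromℕ D ℚ.* fromℕ (suc ℓ)) s≤D*ε ⟩
        fromℕ D ℚ.* fromℕ (suc ℓ) ℚ.+ fromℕ D ℚ.* ε
          ≡⟨ ℚ.*-distribˡ-+ (fromℕ D) (fromℕ (suc ℓ)) ε ⟨
        fromℕ D ℚ.* (fromℕ (suc ℓ) ℚ.+ ε)
          ∎)
    where
    open ℚ.≤-Reasoning
    stuck-bound : ∀ {N w} → D ≤ suc N → Stuck N w (suc (suc ℓ) ∷ ℓs) →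
      D * (w + suc N !) ≤ (D * suc ℓ + s) * suc N !
    stuck-bound {N} {w} D≤N stuck = ≤R.begin
      D * (w + suc N !)                            ≤R.≤⟨ *-monoʳ-≤ D (stuck-weak decreasing stuck) ⟩
      D * (suc ℓ * suc N ! + s * N !)              ≤R.≡⟨ rearrange D (suc ℓ) (suc N !) s (N !) ⟩
      D * suc ℓ * suc N ! + s * (D * N !)
        ≤R.≤⟨ +-monoʳ-≤ (D * suc ℓ * suc N !) (*-monoʳ-≤ s (*-monoˡ-≤ (N !) D≤N)) ⟩
      D * suc ℓ * suc N ! + s * suc N !            ≤R.≡⟨ *-distribʳ-+ (suc N !) (D * suc ℓ) s ⟨
      (D * suc ℓ + s) * suc N !                    ≤R.∎
      where
      module ≤R = ≤-Reasoning
      rearrange : ∀ D l M s K → D * (l * M + s * K) ≡ D * l * M + s * (D * K)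
      rearrange = solve-∀

theorem5p1 : (ℓ₁ : ℕ) (ℓs : List ℕ) →
    Linked _≥_ (ℓ₁ ∷ ℓs) → All (2 ≤_) (ℓ₁ ∷ ℓs) →
    (ℓs ≡ [] ⊎ Linked _>_ (ℓ₁ ∸ 1 ∷ ℓs) → IsUniformlyLBounded (fan (ℓ₁ ∷ ℓs)))
    × (Linked _>_ (ℓ₁ ∷ ℓs) → IsCentrallyLBounded (fan (ℓ₁ ∷ ℓs)))
    × (∀ ℓ₂ ℓs′ → ℓs ≡ ℓ₂ ∷ ℓs′ → ℓ₁ > ℓ₂ → IsLBounded (fan (ℓ₁ ∷ ℓs)))
    × (∀ ℓ₂ ℓs′ → ℓs ≡ ℓ₂ ∷ ℓs′ → ℓ₁ ≡ ℓ₂ →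
    ¬ IsLBounded (fan (ℓ₁ ∷ ℓs)) × IsLowerLBounded (fan (ℓ₁ ∷ ℓs)))
theorem5p1 (suc (suc ℓ)) ℓs decreasing (s≤s (s≤s z≤n) ∷ ≥2) =
    (λ { (inj₁ refl)   → uniformlyBounded decreasing ≥2 [-]
       ; (inj₂ strict) → uniformlyBounded decreasing ≥2 strict })
  , (λ strict → bounded decreasing ≤-refl λ _ → stuck-strict strict ≥2)
  -- With m the number of elements besides the root, every member has corank at least `fanSize`, as
  -- `stuck-gap` requires.
  , (λ { ℓ₂ ℓs′ refl ℓ₁>ℓ₂ → fanSize (suc (suc ℓ) ∷ ℓs) ,
         bounded decreasing (s≤s z≤n) (stuck-gap ℓ₁>ℓ₂ (≤-trans (s≤s z≤n) (All.head ≥2)) decreasing) })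
  , (λ { ℓ₂ ℓs′ refl refl → twoLongest⇒¬bounded ℓ decreasing , lowerBounded decreasing })
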